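{- Let $u,v\in S_n$ and $i\in[n-1]$. The following are equivalent: (1) there exists $\mathbf{a}\in[n]^n$ such that $u\lesssim_{\mathbf{a}}v$ and $i\in\mathrm{Des}_{\mathbf{a}}(v)\cap\mathrm{Asc}_{\mathbf{a}}(u)$; (2) there exists $\mathbf{a}\in[n]^n$ such that $u\lesssim_{\mathbf{a}}v$, $a_i=a_{i+1}$, and $us_i,vs_i\in[u,v]$; (3) the tilted Bruhat interval $[u,v]$ is invariant under right multiplication by $s_i$, i.e. $[u,v]=\{ws_i:w\in[u,v]\}$.
   Context: Permutations are in one-line notation $w=w_1\cdots w_n$, $w[k]:=\{w_1,\dots,w_k\}$; $wt_{ij}$ (resp. $ws_i$) swaps the entries of $w$ in positions $i<j$ (resp. $i,i+1$); $\ell(w)$ is the number of inversions. Quantum Bruhat graph $\Gamma_n$: directed graph on $S_n$ with an edge $w\to wt_{ij}$ ($i<j$) whenever $\ell(wt_{ij})=\ell(w)+1$ or $\ell(wt_{ij})=\ell(w)+1-2(j-i)$; $\ell(x,y)$ is the length of a shortest directed path from $x$ to $y$. Tilted Bruhat interval: $[u,v]:=\{w:\ell(u,w)+\ell(w,v)=\ell(u,v)\}$. Cyclic interval $[a,b)_c$: $\{a,\dots,b-1\}$ if $a\le b$, $\{a,\dots,n\}\cup\{1,\dots,b-1\}$ if $a>b$. For $r\in[n]$, $<_r$ is the total order $r<_r r+1<_r\cdots<_r n<_r1<_r\cdots<_r r-1$; for $k$-subsets $A=\{a_1<_r\cdots<_r a_k\}$, $B=\{b_1<_r\cdots<_r b_k\}$,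 $A\le_r B$ means $a_i\le_r b_i$ for all $i$. For $\mathbf{a}\in[n]^n$: $u\lesssim_{\mathbf{a}}v$ iff $u[k]\le_{a_k}v[k]$ for all $k\in[n]$ and $|u[k]\cap[a_k,a_{k+1})_c|=|v[k]\cap[a_k,a_{k+1})_c|$ for all $k\in[n-1]$. $\mathrm{Des}_{\mathbf{a}}(w):=\{i:a_i=a_{i+1},\ w_i>_{a_i}w_{i+1}\}$, $\mathrm{Asc}_{\mathbf{a}}(w):=\{i:a_i=a_{i+1},\ w_i<_{a_i}w_{i+1}\}$. -}

module Defs where

open import Data.Nat using (ℕ; zero; suc; _+_; _*_; _∸_; _≤_; _<_; _≤ᵇ_; _<ᵇ_)
open import Data.Nat.Properties using (≤-decTotalOrder)
open import Data.Bool using (Bool; true; false; if_then_else_; _∧_; _∨_)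
open import Data.Fin using (Fin; toℕ)
open import Data.Fin.Properties using () renaming (_≟_ to _≟ᶠ_)
open import Data.List using (List; map; take)
open import Data.Nat.ListAction using (sum)
open import Data.Fin.Base using ()
open import Data.List.Base using (allFin)
open import Data.List.Relation.Binary.Pointwise using (Pointwise)
open import Data.List.Sort.InsertionSort ≤-decTotalOrder using (sort)
open import Data.Product using (Σ; _×_; ∃)
open import Data.Sum using (_⊎_)
open import Relation.Nullary using (¬_; does)
open import Relation.Binary.PropositionalEquality using (_≡_; _≗_)
open import Function.Base using (_∘_)

-- Conventions: S_n is modelled by injective maps Fin n → Fin n (one-line notation,
-- w_i = w (i-1)); positions and values are 0-indexed (value k ↔ k+1 in [n]).

Fun : ℕ → Set
Fun n = Fin n → Fin n

swapF : ∀ {n} → Fin n → Fin n → Fin n → Fin n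
swapF i j k = if does (k ≟ᶠ i) then j else (if does (k ≟ᶠ j) then i else k)

inv : ∀ {n} → Fun n → ℕ
inv {n} w = sum (map (λ p → sum (map (λ q →
  if (toℕ p <ᵇ toℕ q) ∧ (toℕ (w q) <ᵇ toℕ (w p)) then 1 else 0) (allFin n))) (allFin n))

-- edges of the quantum Bruhat graph: w → w t_ij (i<j) if
-- ℓ(wt_ij) = ℓ(w)+1 or ℓ(wt_ij) = ℓ(w)+1-2(j-i)
QEdge : ∀ {n} → Fun n → Fun n → Set
QEdge {n} w z = Σ (Fin n) λ i → Σ (Fin n) λ j →
  (toℕ i < toℕ j) × (z ≗ w ∘ swapF i j) ×
  ((inv (w ∘ swapF i j) ≡ suc (inv w)) ⊎
   (inv (w ∘ swapF i j) + 2 * (toℕ j ∸ toℕ i) ≡ suc (inv w)))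

data QPath {n : ℕ} : Fun n → Fun n → ℕ → Set where
  here  : ∀ {x y} → x ≗ y → QPath x y 0
  there : ∀ {x z y d} → QEdge x z → QPath z y d → QPath x y (suc d)

QDist : ∀ {n} → Fun n → Fun n → ℕ → Set
QDist x y d = QPath x y d × (∀ k → k < d → ¬ QPath x y k)

InTilted : ∀ {n} → Fun n → Fun n → Fun n → Set
InTilted u v w = Σ ℕ λ d₁ → Σ ℕ λ d₂ → Σ ℕ λ d →
  QDist u w d₁ × QDist w v d₂ × QDist u v d × (d₁ + d₂ ≡ d)

-- position of x in the cyclic order <_r  (r <_r r+1 <_r ... <_r n <_r 1 <_r ... <_r r-1)
key : ∀ {n} → Fin n → Fin n → ℕ
key {n} r x = if toℕ r ≤ᵇ toℕ x then toℕ x ∸ toℕ r else (toℕ x + n) ∸ toℕ r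

_≤[_]_ : ∀ {n} → Fin n → Fin n → Fin n → Set
x ≤[ r ] y = key r x ≤ key r y

_<[_]_ : ∀ {n} → Fin n → Fin n → Fin n → Set
x <[ r ] y = key r x < key r y

prefix : ∀ {n} → Fun n → ℕ → List (Fin n)
prefix {n} w k = map w (take k (allFin n))

-- A ≤_r B for k-subsets: sort both increasingly in <_r and compare entrywise
-- (sorting the keys is the same as sorting by <_r and taking keys)
GaleLe : ∀ {n} → Fin n → List (Fin n) → List (Fin n) → Set
GaleLe r A B = Pointwise _≤_ (sort (map (key r) A)) (sort (map (key r) B))

inCyc : ∀ {n} → Fin n → Fin n → Fin n → Bool
inCyc a b x = if toℕ a ≤ᵇ toℕ b
  then (toℕ a ≤ᵇ toℕ x) ∧ (toℕ x <ᵇ toℕ b)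
  else (toℕ a ≤ᵇ toℕ x) ∨ (toℕ x <ᵇ toℕ b)

countCyc : ∀ {n} → Fin n → Fin n → List (Fin n) → ℕ
countCyc a b xs = sum (map (λ x → if inCyc a b x then 1 else 0) xs)

-- u ≲_a v  (position p : Fin n corresponds to k = p+1)
LeA : ∀ {n} → (Fin n → Fin n) → Fun n → Fun n → Set
LeA {n} a u v =
  (∀ (p : Fin n) → GaleLe (a p) (prefix u (suc (toℕ p))) (prefix v (suc (toℕ p)))) ×
  (∀ (p q : Fin n) → toℕ q ≡ suc (toℕ p) →
     countCyc (a p) (a q) (prefix u (suc (toℕ p))) ≡ countCyc (a p) (a q) (prefix v (suc (toℕ p))))

-- i ∈ Des_a(w) and i ∈ Asc_a(w), where i, i' are consecutive positions (i' = i+1)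
InDes : ∀ {n} → (Fin n → Fin n) → Fun n → Fin n → Fin n → Set
InDes a w i i' = (a i ≡ a i') × (w i' <[ a i ] w i)

InAsc : ∀ {n} → (Fin n → Fin n) → Fun n → Fin n → Fin n → Set
InAsc a w i i' = (a i ≡ a i') × (w i <[ a i ] w i')

IsPerm : ∀ {n} → Fun n → Set
IsPerm {n} w = ∀ (x y : Fin n) → w x ≡ w y → x ≡ y

{-# OPTIONS --safe #-}
-- For 0 ≤ m ≤ n let e_m(b) = |{x ∈ v[m] : x < b}| − |{x ∈ u[m] : x < b}|. Along an edge of the
-- quantum Bruhat graph the m-th exponent of q is at least max e_m, and moving the first entry
-- u_k ≠ v_k to the next entry cyclically between u_k and v_k attains this bound for all m at once,
-- so ℓ(u,v) = ℓ(v) − ℓ(u) + 2 Σ_m max e_m(u,v). Since the e_m are additive, w ∈ [u,v] iff for each m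
-- every maximiser of e_m(u,v) also maximises e_m(u,w) and e_m(w,v); moreover u[m] ≤_r v[m] iff r
-- maximises e_m, and u ≲_a v iff a_m maximises both e_{m-1} and e_m.
-- If one r serves for the lengths i-1, i and i+1, then (1), (2) and (3) are equivalent by the
-- lifting property of ≤_r. If no such r exists, there are maximisers r and s of e_i which separate
-- {u_i, u_{i+1}} from {v_i, v_{i+1}}; a geodesic from u to v then visits some w with r and s
-- separating w_i from w_{i+1}, and w s_i ∉ [u,v], which contradicts (3).
module Submission where

open import Defs
open import Algebra.Properties.CommutativeMonoid.Sum using ()
open import Data.Bool using (Bool; true; false; if_then_else_; _∧_)
open import Data.Bool.Properties using () renaming (_≟_ to _≟ᵇ_)
open import Data.Empty using (⊥; ⊥-elim)
open import Data.Fin using (Fin; zero; suc; toℕ; fromℕ<; punchOut; inject₁)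
open import Data.Fin.Properties using (toℕ-injective; toℕ<n; toℕ-fromℕ<; toℕ-inject₁; any?; all?; ¬∀⟶∃¬; punchOut-injective; <⇒notInjective) renaming (_≟_ to _≟ᶠ_)
open import Data.List using (List; []; _∷_; map; take; allFin; tabulate; length)
open import Data.List.Properties using (map-∘; length-map)
open import Data.List.Relation.Binary.Permutation.Propositional.Properties using (map⁺; ↭-length)
open import Data.List.Relation.Binary.Pointwise using (Pointwise; []; _∷_)
open import Data.List.Relation.Unary.Linked using ([]; [-]; _∷_) renaming (tail to sorted-tail)
open import Data.Nat using (ℕ; zero; suc; _+_; _*_; _∸_; _≤_; _<_; _≤ᵇ_; _<ᵇ_; z≤n; s≤s; _≤?_; _<?_; z<s; s<s; s<s⁻¹; s≤s⁻¹)
open import Data.Nat.ListAction using () renaming (sum to listSum)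
open import Data.Nat.ListAction.Properties using (sum-↭)
open import Data.Nat.Properties
open import Data.Nat.Tactic.RingSolver using (solve-∀)
open import Data.List.Relation.Unary.Sorted.TotalOrder ≤-totalOrder using (Sorted)
open import Data.List.Sort.InsertionSort ≤-decTotalOrder using (sort)
import Data.List.Sort.InsertionSort.Properties ≤-decTotalOrder as InsertionSort
open import Data.Product using (Σ; ∃; _×_; _,_; proj₁; proj₂)
open import Data.Sum using (_⊎_; inj₁; inj₂)
open import Function.Base using (_∘_)
open import Function.Bundles using (_⇔_; mk⇔; Equivalence)
open import Relation.Binary.Definitions using (Tri; tri<; tri≈; tri>)
open import Relation.Binary.PropositionalEquality
open import Relation.Nullary using (¬_; Dec; yes; no; does; contradiction)
open import Relation.Nullary.Decidable using (_×-dec_; _⊎-dec_; ¬?; decidable-stable; dec-true; dec-false)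
open import Relation.Nullary.Reflects using (ofʸ; ofⁿ)

-- Membership in `[u,v]` speaks only of lengths of shortest paths. The formula makes it usable
-- because the triangle inequality holds for each prefix length separately, so equality of the sums
-- forces equality at every length. The greedy edge meets the bound for all lengths at once because
-- it raises the excess, counted together with the exponent of the edge, only at cuts that were not
-- maximal. Two consecutive lengths always share a maximiser, since the increment of the excess
-- takes only two neighbouring values; three lengths need not share one, and `a_i = a_{i+1}` asks
-- exactly for that. If sharing fails, the increments at both positions `i` and `i+1` grow strictly
-- from `r` to `s`. This puts `u_i, u_{i+1}` on one arc between the two cuts and `v_i, v_{i+1}` on
-- the other, and a single transposition cannot carry a pair on one arc to a pair on the other.
-- Subtraction is avoided throughout: `excess` and `D` carry the shift `m`, `K n` collects the
-- shifts, and inequalities stay additive so that `linear` can close them.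

private module Sum = Algebra.Properties.CommutativeMonoid.Sum +-0-commutativeMonoid

toℕ-<⇒≢ : ∀ {n} {p q : Fin n} → toℕ p < toℕ q → p ≢ q
toℕ-<⇒≢ p<q refl = <-irrefl refl p<q

-- Farkas' rule: l ≤ r is a sum of hypotheses and the equation is left to the semiring solver.
linear : ∀ {a b l r} → l ≤ r → a + r ≡ b + l → a ≤ b
linear {a} {b} {l} {r} l≤r eq = +-cancelʳ-≤ l a b (≤-trans (+-monoʳ-≤ a l≤r) (≤-reflexive eq))

-- Parity absorbs the extra 1. The lifting property needs this slack, because averaging two counts
-- loses up to one half.
halve-≤ : ∀ {a b} → 2 * a ≤ 1 + 2 * b → a ≤ b
halve-≤ {a} {b} h with a ≤? b
... | yes a≤b = a≤b
... | no a≰b = contradiction (linear {2 + 2 * b} {1 + 2 * b} (+-mono-≤ h (*-monoʳ-≤ 2 (≰⇒> a≰b))) (lemma a b)) 1+n≰n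
  where
  lemma : ∀ a b → 2 + 2 * b + (1 + 2 * b + 2 * a) ≡ 1 + 2 * b + (2 * a + 2 * suc b)
  lemma = solve-∀

-- Zero-one indicators of strict inequalities.

opaque
  ⟦_<_⟧ : ℕ → ℕ → ℕ
  ⟦ x < y ⟧ = if x <ᵇ y then 1 else 0

  ⟦<⟧-yes : ∀ {x y} → x < y → ⟦ x < y ⟧ ≡ 1
  ⟦<⟧-yes {x} {y} x<y with x <ᵇ y | <ᵇ-reflects-< x y
  ... | true | _ = refl
  ... | false | ofⁿ x≮y = contradiction x<y x≮y

  ⟦<⟧-no : ∀ {x y} → y ≤ x → ⟦ x < y ⟧ ≡ 0
  ⟦<⟧-no {x} {y} y≤x with x <ᵇ y | <ᵇ-reflects-< x y
  ... | true | ofʸ x<y = contradiction y≤x (<⇒≱ x<y)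
  ... | false | _ = refl

  ⟦<⟧-if : ∀ x y → ⟦ x < y ⟧ ≡ (if x <ᵇ y then 1 else 0)
  ⟦<⟧-if x y = refl

-- `⟦ y < suc x ⟧` is the indicator of `y ≤ x`. The indicators are opaque, so a case distinction
-- hands over their values as equations for `rewrite`.
data Cmp (x y : ℕ) : Set where
  less : x < y → ⟦ x < y ⟧ ≡ 1 → ⟦ y < suc x ⟧ ≡ 0 → Cmp x y
  geq  : y ≤ x → ⟦ x < y ⟧ ≡ 0 → ⟦ y < suc x ⟧ ≡ 1 → Cmp x y

cmp : ∀ x y → Cmp x y
cmp x y with x <? y
... | yes x<y = less x<y (⟦<⟧-yes x<y) (⟦<⟧-no x<y)
... | no x≮y = geq (≮⇒≥ x≮y) (⟦<⟧-no (≮⇒≥ x≮y)) (⟦<⟧-yes (s≤s (≮⇒≥ x≮y)))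

⟦<⟧≤1 : ∀ x y → ⟦ x < y ⟧ ≤ 1
⟦<⟧≤1 x y with cmp x y
... | less _ e _ = ≤-reflexive e
... | geq _ e _ = ≤-trans (≤-reflexive e) z≤n

⟦<⟧-mono : ∀ {x y x' y'} → (x < y → x' < y') → ⟦ x < y ⟧ ≤ ⟦ x' < y' ⟧
⟦<⟧-mono {x} {y} {x'} {y'} f with cmp x y
... | geq _ e _ = ≤-trans (≤-reflexive e) z≤n
... | less x<y e _ = ≤-reflexive (trans e (sym (⟦<⟧-yes (f x<y))))

⟦<⟧-cong : ∀ {x y x' y'} → (x < y → x' < y') → (x' < y' → x < y) → ⟦ x < y ⟧ ≡ ⟦ x' < y' ⟧
⟦<⟧-cong {x} {y} {x'} {y'} f g = ≤-antisym (⟦<⟧-mono {x} {y} {x'} {y'} f) (⟦<⟧-mono {x'} {y'} {x} {y} g)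

⟦<⟧-complement : ∀ x y → ⟦ x < y ⟧ + ⟦ y < suc x ⟧ ≡ 1
⟦<⟧-complement x y with cmp x y
... | less _ e e' = cong₂ _+_ e e'
... | geq _ e e' = cong₂ _+_ e e'

⟦<⟧-total : ∀ x y → ¬ (x ≡ y) → ⟦ x < y ⟧ + ⟦ y < x ⟧ ≡ 1
⟦<⟧-total x y x≢y with cmp x y
... | less x<y e _ = cong₂ _+_ e (⟦<⟧-no (<⇒≤ x<y))
... | geq y≤x e _ = cong₂ _+_ e (⟦<⟧-yes (≤∧≢⇒< y≤x (x≢y ∘ sym)))

if-∧ : ∀ x y → (if x ∧ y then 1 else 0) ≡ (if x then 1 else 0) * (if y then 1 else 0)
if-∧ true true = refl
if-∧ true false = refl
if-∧ false y = refl

-- Finite sums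

opaque
  sum : ∀ {n} → (Fin n → ℕ) → ℕ
  sum = Sum.sum

  sum-cong : ∀ {n} {f g : Fin n → ℕ} → f ≗ g → sum f ≡ sum g
  sum-cong = Sum.sum-cong-≗

  sum-empty : (f : Fin 0 → ℕ) → sum f ≡ 0
  sum-empty f = refl

  sum-head : ∀ {n} (f : Fin (suc n) → ℕ) → sum f ≡ f zero + sum (f ∘ suc)
  sum-head f = refl

  sum-+ : ∀ {n} (f g : Fin n → ℕ) → sum (λ p → f p + g p) ≡ sum f + sum g
  sum-+ = Sum.∑-distrib-+

  sum-mono : ∀ {n} (f g : Fin n → ℕ) → (∀ p → f p ≤ g p) → sum f ≤ sum g
  sum-mono {zero} f g f≤g = z≤n
  sum-mono {suc n} f g f≤g = +-mono-≤ (f≤g zero) (sum-mono (f ∘ suc) (g ∘ suc) (f≤g ∘ suc))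

  sum-mono-strict : ∀ {n} (f g : Fin n → ℕ) → (∀ p → f p ≤ g p) → ∀ q → f q < g q → sum f < sum g
  sum-mono-strict {suc n} f g f≤g zero fq<gq = +-mono-<-≤ fq<gq (sum-mono (f ∘ suc) (g ∘ suc) (f≤g ∘ suc))
  sum-mono-strict {suc n} f g f≤g (suc q) fq<gq =
    +-mono-≤-< (f≤g zero) (sum-mono-strict (f ∘ suc) (g ∘ suc) (f≤g ∘ suc) q fq<gq)

  sum-scale : ∀ {n} c (f : Fin n → ℕ) → sum (λ p → c * f p) ≡ c * sum f
  sum-scale {zero} c f = sym (*-zeroʳ c)
  sum-scale {suc n} c f = trans (cong (c * f zero +_) (sum-scale c (f ∘ suc))) (sym (*-distribˡ-+ c (f zero) (sum (f ∘ suc))))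

  sum-bound : ∀ {n} c (f : Fin n → ℕ) → (∀ p → f p ≤ c) → sum f ≤ n * c
  sum-bound {zero} c f f≤c = z≤n
  sum-bound {suc n} c f f≤c = +-mono-≤ (f≤c zero) (sum-bound c (f ∘ suc) (f≤c ∘ suc))

  sum-zero : ∀ {n} (f : Fin n → ℕ) → (∀ p → f p ≡ 0) → sum f ≡ 0
  sum-zero {n} f f≡0 = n≤0⇒n≡0 (≤-trans (sum-bound 0 f (≤-reflexive ∘ f≡0)) (≤-reflexive (*-zeroʳ n)))

  sum-tabulate : ∀ {n} {A : Set} (h : A → ℕ) (e : Fin n → A) → listSum (map h (tabulate e)) ≡ sum (h ∘ e)
  sum-tabulate {zero} h e = refl
  sum-tabulate {suc n} h e = cong (h (e zero) +_) (sum-tabulate h (e ∘ suc))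

  sum-threshold : ∀ {n} m → m ≤ n → sum {n} (λ p → ⟦ toℕ p < m ⟧) ≡ m
  sum-threshold {zero} .zero z≤n = refl
  sum-threshold {suc n} zero m≤n = sum-zero {suc n} _ (λ p → ⟦<⟧-no {toℕ p} z≤n)
  sum-threshold {suc n} (suc m) (s≤s m≤n) = cong₂ _+_ (⟦<⟧-yes {0} z<s)
    (trans (sum-cong {n} {λ p → ⟦ suc (toℕ p) < suc m ⟧} {λ p → ⟦ toℕ p < m ⟧} λ p → ⟦<⟧-cong s<s⁻¹ s<s) (sum-threshold m m≤n))

sum-≤-≡ : ∀ {n} (f g : Fin n → ℕ) → (∀ p → f p ≤ g p) → sum g ≤ sum f → ∀ p → f p ≡ g p
sum-≤-≡ f g f≤g sg≤sf p with f p ≟ g p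
... | yes e = e
... | no fp≢gp = contradiction (sum-mono-strict f g f≤g p (≤∧≢⇒< (f≤g p) fp≢gp)) (≤⇒≯ sg≤sf)

δ : ∀ {n} → Fin n → Fin n → ℕ
δ p q = if does (q ≟ᶠ p) then 1 else 0

opaque
  unfolding sum
  sum-δ : ∀ {n} (i : Fin n) (h : Fin n → ℕ) → sum (λ p → δ i p * h i) ≡ h i
  sum-δ {suc n} zero h = trans (cong₂ _+_ (*-identityˡ (h zero)) (sum-zero {n} _ (λ p → refl))) (+-identityʳ (h zero))
  sum-δ {suc n} (suc i) h = trans (sum-cong {n} {λ p → δ (suc i) (suc p) * h (suc i)} (λ p → cong (_* h (suc i)) (δ-suc p))) (sum-δ i (h ∘ suc))
    where
    δ-suc : ∀ p → δ (suc i) (suc p) ≡ δ i p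
    δ-suc p with p ≟ᶠ i
    ... | yes _ = refl
    ... | no _ = refl

off : ∀ {n} → Fin n → Fin n → Fin n → ℕ
off i j p = if does (p ≟ᶠ i) then 0 else (if does (p ≟ᶠ j) then 0 else 1)

sum-split : ∀ {n} {i j : Fin n} → i ≢ j → (h : Fin n → ℕ) →
  sum h ≡ h i + h j + sum (λ p → off i j p * h p)
sum-split {n} {i} {j} i≢j h = begin
  sum h ≡⟨ sum-cong pointwise ⟩
  sum (λ p → (δ i p * h i + δ j p * h j) + off i j p * h p) ≡⟨ sum-+ (λ p → δ i p * h i + δ j p * h j) _ ⟩
  sum (λ p → δ i p * h i + δ j p * h j) + sum (λ p → off i j p * h p)
    ≡⟨ cong (_+ sum (λ p → off i j p * h p)) (trans (sum-+ (λ p → δ i p * h i) _) (cong₂ _+_ (sum-δ i h) (sum-δ j h))) ⟩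
  h i + h j + sum (λ p → off i j p * h p) ∎
  where
  open ≡-Reasoning
  first : ∀ x y → x ≡ 1 * x + 0 * y + 0 * x
  first = solve-∀
  second : ∀ x y → x ≡ 0 * y + 1 * x + 0 * x
  second = solve-∀
  third : ∀ x y z → x ≡ 0 * y + 0 * z + 1 * x
  third = solve-∀
  pointwise : ∀ p → h p ≡ (δ i p * h i + δ j p * h j) + off i j p * h p
  pointwise p with p ≟ᶠ i | p ≟ᶠ j
  ... | yes refl | yes refl = contradiction refl i≢j
  ... | yes refl | no _ = first (h p) (h j)
  ... | no _ | yes refl = second (h p) (h i)
  ... | no _ | no _ = third (h p) (h i) (h j)

off-cong : ∀ {n} {i j : Fin n} {f g : Fin n → ℕ} → (∀ p → p ≢ i → p ≢ j → f p ≡ g p) →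
  ∀ p → off i j p * f p ≡ off i j p * g p
off-cong {i = i} {j} f≡g p with p ≟ᶠ i | p ≟ᶠ j
... | yes _ | _ = refl
... | no _ | yes _ = refl
... | no p≢i | no p≢j = cong (1 *_) (f≡g p p≢i p≢j)

-- Transpositions of positions and permutations as injective maps.

swapF-left : ∀ {n} (i j : Fin n) → swapF i j i ≡ j
swapF-left i j with i ≟ᶠ i
... | yes _ = refl
... | no i≢i = contradiction refl i≢i

swapF-right : ∀ {n} (i j : Fin n) → swapF i j j ≡ i
swapF-right i j with j ≟ᶠ i
... | yes e = e
... | no _ with j ≟ᶠ j
...   | yes _ = refl
...   | no j≢j = contradiction refl j≢j

swapF-off : ∀ {n} {i j k : Fin n} → k ≢ i → k ≢ j → swapF i j k ≡ k
swapF-off {i = i} {j} {k} k≢i k≢j with k ≟ᶠ i | k ≟ᶠ j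
... | yes e | _ = contradiction e k≢i
... | no _ | yes e = contradiction e k≢j
... | no _ | no _ = refl

swapF-involutive : ∀ {n} (i j k : Fin n) → swapF i j (swapF i j k) ≡ k
swapF-involutive i j k with k ≟ᶠ i | k ≟ᶠ j
... | yes refl | _ = swapF-right i j
... | no _ | yes refl = swapF-left i j
... | no k≢i | no k≢j = swapF-off k≢i k≢j

swapF-perm : ∀ {n} {w : Fun n} (i j : Fin n) → IsPerm w → IsPerm (w ∘ swapF i j)
swapF-perm i j w-perm x y e =
  trans (sym (swapF-involutive i j x)) (trans (cong (swapF i j) (w-perm _ _ e)) (swapF-involutive i j y))

perm-cong : ∀ {n} {w z : Fun n} → z ≗ w → IsPerm w → IsPerm z
perm-cong z≗w w-perm x y e = w-perm x y (trans (sym (z≗w x)) (trans e (z≗w y)))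

perm-≢ : ∀ {n} {w : Fun n} → IsPerm w → ∀ {x y} → x ≢ y → ¬ (toℕ (w x) ≡ toℕ (w y))
perm-≢ w-perm x≢y e = x≢y (w-perm _ _ (toℕ-injective e))

-- Inversions

inversion : ∀ {n} → Fun n → Fin n → Fin n → ℕ
inversion w p q = ⟦ toℕ p < toℕ q ⟧ * ⟦ toℕ (w q) < toℕ (w p) ⟧

inv-sum : ∀ {n} (w : Fun n) → inv w ≡ sum (λ p → sum (λ q → inversion w p q))
inv-sum {n} w = trans (sum-tabulate {n} _ _) (sum-cong λ p →
  trans (sum-tabulate {n} _ _) (sum-cong λ q → trans (if-∧ (toℕ p <ᵇ toℕ q) (toℕ (w q) <ᵇ toℕ (w p)))
    (sym (cong₂ _*_ (⟦<⟧-if (toℕ p) (toℕ q)) (⟦<⟧-if (toℕ (w q)) (toℕ (w p)))))))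

inv-cong : ∀ {n} {w z : Fun n} → w ≗ z → inv w ≡ inv z
inv-cong {w = w} {z} e = trans (inv-sum w) (trans
  (sum-cong λ p → sum-cong λ q → cong₂ (λ x y → ⟦ toℕ p < toℕ q ⟧ * ⟦ toℕ x < toℕ y ⟧) (e q) (e p)) (sym (inv-sum z)))

inv≤n*n : ∀ {n} (w : Fun n) → inv w ≤ n * (n * 1)
inv≤n*n w = ≤-trans (≤-reflexive (inv-sum w)) (sum-bound _ _ λ p → sum-bound 1 _ λ q →
  *-mono-≤ (⟦<⟧≤1 (toℕ p) (toℕ q)) (⟦<⟧≤1 (toℕ (w q)) (toℕ (w p))))

-- Pairs inside the two chosen positions, pairs of another position with one of them, and pairs
-- avoiding both are kept apart: an exchange of the two positions affects only the first two kinds.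
double-sum-split : ∀ {n} {i j : Fin n} → i ≢ j → (h : Fin n → Fin n → ℕ) →
  sum (λ p → sum (h p)) ≡ h i i + h i j + h j i + h j j
    + sum (λ p → off i j p * (h i p + h j p + (h p i + h p j) + sum (λ q → off i j q * h p q)))
double-sum-split {i = i} {j} i≢j h = begin
  sum (λ p → sum (h p)) ≡⟨ sum-split i≢j (λ p → sum (h p)) ⟩
  sum (h i) + sum (h j) + sum (λ p → off i j p * sum (h p))
    ≡⟨ cong₂ _+_ (cong₂ _+_ (sum-split i≢j (h i)) (sum-split i≢j (h j)))
         (sum-cong λ p → cong (off i j p *_) (sum-split i≢j (h p))) ⟩
  h i i + h i j + A + (h j i + h j j + B) + C ≡⟨ rearrange (h i i) (h i j) (h j i) (h j j) A B C ⟩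
  corners + (A + B + C) ≡⟨ cong (λ x → corners + (x + C)) (sym (sum-+ (λ p → off i j p * h i p) _)) ⟩
  corners + (sum (λ p → off i j p * h i p + off i j p * h j p) + C)
    ≡⟨ cong (corners +_) (sym (sum-+ (λ p → off i j p * h i p + off i j p * h j p) _)) ⟩
  corners + sum (λ p → off i j p * h i p + off i j p * h j p + off i j p * (h p i + h p j + sum (λ q → off i j q * h p q)))
    ≡⟨ cong (corners +_) (sum-cong λ p → collect (off i j p) (h i p) (h j p) (h p i + h p j) _) ⟩
  corners + sum (λ p → off i j p * (h i p + h j p + (h p i + h p j) + sum (λ q → off i j q * h p q))) ∎
  where
  open ≡-Reasoning
  corners A B C : ℕ
  corners = h i i + h i j + h j i + h j j
  A = sum (λ p → off i j p * h i p)
  B = sum (λ p → off i j p * h j p)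
  C = sum (λ p → off i j p * (h p i + h p j + sum (λ q → off i j q * h p q)))
  rearrange : ∀ a b c d A B C → a + b + A + (c + d + B) + C ≡ a + b + c + d + (A + B + C)
  rearrange = solve-∀
  collect : ∀ o a b c d → o * a + o * b + o * (c + d) ≡ o * (a + b + c + d)
  collect = solve-∀

-- Indicator that the point `(p , w p)` lies strictly inside the rectangle with corners `(i , w i)`
-- and `(j , w j)`.
between : ∀ {n} → Fun n → Fin n → Fin n → Fin n → ℕ
between w i j p = (⟦ toℕ i < toℕ p ⟧ * ⟦ toℕ p < toℕ j ⟧) * (⟦ toℕ (w i) < toℕ (w p) ⟧ * ⟦ toℕ (w p) < toℕ (w j) ⟧)

between-left : ∀ {n} (w : Fun n) i j → between w i j i ≡ 0
between-left w i j = cong (λ x → (x * ⟦ toℕ i < toℕ j ⟧) * (⟦ toℕ (w i) < toℕ (w i) ⟧ * ⟦ toℕ (w i) < toℕ (w j) ⟧)) (⟦<⟧-no ≤-refl)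

between-right : ∀ {n} (w : Fun n) i j → between w i j j ≡ 0
between-right w i j = cong (_* (⟦ toℕ (w i) < toℕ (w j) ⟧ * ⟦ toℕ (w j) < toℕ (w j) ⟧))
  (trans (cong (⟦ toℕ i < toℕ j ⟧ *_) (⟦<⟧-no {toℕ j} ≤-refl)) (*-zeroʳ ⟦ toℕ i < toℕ j ⟧))

-- The four terms on each side are the inversions between the position p (value x) and the
-- positions i < j (values a < c), after and before the exchange.
exchange : ∀ {i j a c} p x → i < j → a < c → ¬ (p ≡ i) → ¬ (p ≡ j) → ¬ (x ≡ a) → ¬ (x ≡ c) →
  ⟦ i < p ⟧ * ⟦ x < c ⟧ + ⟦ j < p ⟧ * ⟦ x < a ⟧ + (⟦ p < i ⟧ * ⟦ c < x ⟧ + ⟦ p < j ⟧ * ⟦ a < x ⟧) ≡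
  ⟦ i < p ⟧ * ⟦ x < a ⟧ + ⟦ j < p ⟧ * ⟦ x < c ⟧ + (⟦ p < i ⟧ * ⟦ a < x ⟧ + ⟦ p < j ⟧ * ⟦ c < x ⟧)
    + 2 * ((⟦ i < p ⟧ * ⟦ p < j ⟧) * (⟦ a < x ⟧ * ⟦ x < c ⟧))
exchange {i} {j} {a} {c} p x i<j a<c p≢i p≢j x≢a x≢c with cmp p i | cmp p j
... | less p<i e _ | _
  rewrite e | ⟦<⟧-no {i} {p} (<⇒≤ p<i) | ⟦<⟧-no {j} {p} (<⇒≤ (<-trans p<i i<j)) | ⟦<⟧-yes (<-trans p<i i<j)
  = lemma ⟦ c < x ⟧ ⟦ a < x ⟧ (⟦ a < x ⟧ * ⟦ x < c ⟧)
  where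
  lemma : ∀ C A M → 1 * C + 1 * A ≡ 1 * A + 1 * C + 2 * (0 * M)
  lemma = solve-∀
... | geq i≤p e _ | geq j≤p e' _
  rewrite e | e' | ⟦<⟧-yes (≤∧≢⇒< i≤p (p≢i ∘ sym)) | ⟦<⟧-yes (≤∧≢⇒< j≤p (p≢j ∘ sym))
  = lemma ⟦ x < c ⟧ ⟦ x < a ⟧ (⟦ a < x ⟧ * ⟦ x < c ⟧)
  where
  lemma : ∀ C A M → 1 * C + 1 * A + (0 * 1 + 0 * 1) ≡ 1 * A + 1 * C + (0 * 1 + 0 * 1) + 2 * (0 * M)
  lemma = solve-∀
... | geq i≤p e _ | less p<j e' _
  rewrite e | e' | ⟦<⟧-yes (≤∧≢⇒< i≤p (p≢i ∘ sym)) | ⟦<⟧-no {j} (<⇒≤ p<j)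
  with cmp x a | cmp x c
... | less x<a f _ | _ rewrite f | ⟦<⟧-yes (<-trans x<a a<c) | ⟦<⟧-no {a} (<⇒≤ x<a) | ⟦<⟧-no {c} (<⇒≤ (<-trans x<a a<c)) = refl
... | geq a≤x f _ | less x<c f' _ rewrite f | f' | ⟦<⟧-yes (≤∧≢⇒< a≤x (x≢a ∘ sym)) | ⟦<⟧-no {c} (<⇒≤ x<c) = refl
... | geq a≤x f _ | geq c≤x f' _ rewrite f | f' | ⟦<⟧-yes (≤∧≢⇒< a≤x (x≢a ∘ sym)) | ⟦<⟧-yes (≤∧≢⇒< c≤x (x≢c ∘ sym)) = refl

-- The pair `(i , j)` itself becomes an inversion, and by `exchange` each point inside the rectangle
-- creates two more; all other contributions balance.
inv-swap : ∀ {n} {w : Fun n} → IsPerm w → ∀ {i j} → toℕ i < toℕ j → toℕ (w i) < toℕ (w j) →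
  inv (w ∘ swapF i j) ≡ 1 + inv w + 2 * sum (between w i j)
inv-swap {n} {w} w-perm {i} {j} i<j a<c = begin
  inv w' ≡⟨ trans (inv-sum w') (double-sum-split i≢j h') ⟩
  h' i i + h' i j + h' j i + h' j j + sum (λ p → off i j p * (G' p + R' p))
    ≡⟨ cong₂ _+_ corners rest ⟩
  1 + (h i i + h i j + h j i + h j j) + (sum (λ p → off i j p * (G p + R p)) + 2 * sum (between w i j))
    ≡⟨ regroup (h i i + h i j + h j i + h j j) (sum (λ p → off i j p * (G p + R p))) (sum (between w i j)) ⟩
  1 + (h i i + h i j + h j i + h j j + sum (λ p → off i j p * (G p + R p))) + 2 * sum (between w i j)
    ≡⟨ cong (λ x → 1 + x + 2 * sum (between w i j)) (sym (trans (inv-sum w) (double-sum-split i≢j h))) ⟩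
  1 + inv w + 2 * sum (between w i j) ∎
  where
  open ≡-Reasoning
  w' : Fun n
  w' = w ∘ swapF i j
  h h' : Fin n → Fin n → ℕ
  h = inversion w
  h' = inversion w'
  G G' R R' : Fin n → ℕ
  G p = h i p + h j p + (h p i + h p j)
  G' p = h' i p + h' j p + (h' p i + h' p j)
  R p = sum (λ q → off i j q * h p q)
  R' p = sum (λ q → off i j q * h' p q)
  i≢j : i ≢ j
  i≢j = toℕ-<⇒≢ i<j
  regroup : ∀ a b c → 1 + a + (b + 2 * c) ≡ 1 + (a + b) + 2 * c
  regroup = solve-∀
  w'i : w' i ≡ w j
  w'i = cong w (swapF-left i j)
  w'j : w' j ≡ w i
  w'j = cong w (swapF-right i j)
  w'off : ∀ {p} → p ≢ i → p ≢ j → w' p ≡ w p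
  w'off p≢i p≢j = cong w (swapF-off p≢i p≢j)
  corners : h' i i + h' i j + h' j i + h' j j ≡ 1 + (h i i + h i j + h j i + h j j)
  corners
    rewrite w'i | w'j | ⟦<⟧-no {toℕ i} ≤-refl | ⟦<⟧-no {toℕ j} ≤-refl | ⟦<⟧-yes i<j
          | ⟦<⟧-no {toℕ j} {toℕ i} (<⇒≤ i<j) | ⟦<⟧-yes a<c | ⟦<⟧-no {toℕ (w j)} {toℕ (w i)} (<⇒≤ a<c) = refl
  between-off : ∀ p → off i j p * between w i j p ≡ between w i j p
  between-off p with p ≟ᶠ i | p ≟ᶠ j
  ... | yes refl | _ = sym (between-left w i j)
  ... | no _ | yes refl = sym (between-right w i j)
  ... | no _ | no _ = *-identityˡ _
  rest-pointwise : ∀ p → p ≢ i → p ≢ j → G' p + R' p ≡ G p + R p + 2 * between w i j p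
  rest-pointwise p p≢i p≢j = trans (cong₂ _+_ G≡ R≡) (comm (G p) (R p) (2 * between w i j p))
    where
    comm : ∀ a b c → a + c + b ≡ a + b + c
    comm = solve-∀
    R≡ : R' p ≡ R p
    R≡ = sum-cong (off-cong λ q q≢i q≢j →
      cong₂ (λ x y → ⟦ toℕ p < toℕ q ⟧ * ⟦ toℕ x < toℕ y ⟧) (w'off q≢i q≢j) (w'off p≢i p≢j))
    G≡ : G' p ≡ G p + 2 * between w i j p
    G≡ rewrite w'i | w'j | w'off p≢i p≢j = exchange (toℕ p) (toℕ (w p)) i<j a<c
      (p≢i ∘ toℕ-injective) (p≢j ∘ toℕ-injective) (perm-≢ w-perm p≢i) (perm-≢ w-perm p≢j)
  rest : sum (λ p → off i j p * (G' p + R' p)) ≡ sum (λ p → off i j p * (G p + R p)) + 2 * sum (between w i j)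
  rest = begin
    sum (λ p → off i j p * (G' p + R' p)) ≡⟨ sum-cong (off-cong rest-pointwise) ⟩
    sum (λ p → off i j p * (G p + R p + 2 * between w i j p))
      ≡⟨ sum-cong (λ p → trans (distr (off i j p) (G p + R p) (between w i j p))
           (cong (λ x → off i j p * (G p + R p) + 2 * x) (between-off p))) ⟩
    sum (λ p → off i j p * (G p + R p) + 2 * between w i j p) ≡⟨ sum-+ (λ p → off i j p * (G p + R p)) _ ⟩
    sum (λ p → off i j p * (G p + R p)) + sum (λ p → 2 * between w i j p)
      ≡⟨ cong (sum (λ p → off i j p * (G p + R p)) +_) (sum-scale 2 (between w i j)) ⟩
    sum (λ p → off i j p * (G p + R p)) + 2 * sum (between w i j) ∎
    where
    distr : ∀ o a b → o * (a + 2 * b) ≡ o * a + 2 * (o * b)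
    distr = solve-∀

-- Prefix sums

prefixSum : ∀ {n} → ℕ → (Fin n → ℕ) → ℕ
prefixSum m h = sum (λ p → ⟦ toℕ p < m ⟧ * h p)

-- Indicator of `i < m ≤ j`. With positions counted from 0 these are the lengths whose prefix
-- contains position `i` but not `j`, that is, those whose entry set changes when the two are
-- exchanged.
window : ℕ → ℕ → ℕ → ℕ
window i j m = ⟦ i < m ⟧ * ⟦ m < suc j ⟧

prefixSum-cong : ∀ {n} m {g h : Fin n → ℕ} → (∀ p → g p ≡ h p) → prefixSum m g ≡ prefixSum m h
prefixSum-cong m g≡h = sum-cong λ p → cong (⟦ toℕ p < m ⟧ *_) (g≡h p)

prefixSum-+ : ∀ {n} m (g h : Fin n → ℕ) → prefixSum m (λ p → g p + h p) ≡ prefixSum m g + prefixSum m h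
prefixSum-+ m g h = trans (sum-cong λ p → *-distribˡ-+ ⟦ toℕ p < m ⟧ (g p) (h p)) (sum-+ _ _)

prefixSum-one : ∀ {n m} → m ≤ n → prefixSum {n} m (λ p → 1) ≡ m
prefixSum-one {n} {m} m≤n = trans (sum-cong λ p → *-identityʳ ⟦ toℕ p < m ⟧) (sum-threshold m m≤n)

prefixSum-zero : ∀ {n} (h : Fin n → ℕ) → prefixSum 0 h ≡ 0
prefixSum-zero h = sum-zero _ λ p → cong (_* h p) (⟦<⟧-no z≤n)

prefixSum-head : ∀ {n} k (h : Fin (suc n) → ℕ) → prefixSum (suc k) h ≡ h zero + prefixSum k (h ∘ suc)
prefixSum-head {n} k h = trans (sum-head {n} _) (cong₂ _+_
  (trans (cong (_* h zero) (⟦<⟧-yes {0} {suc k} z<s)) (*-identityˡ (h zero)))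
  (sum-cong λ p → cong (_* h (suc p)) (⟦<⟧-cong {suc (toℕ p)} {suc k} s≤s⁻¹ s≤s)))

prefixSum-suc : ∀ {n} (k : Fin n) (h : Fin n → ℕ) → prefixSum (suc (toℕ k)) h ≡ prefixSum (toℕ k) h + h k
prefixSum-suc k h = trans (sum-cong pointwise) (trans (sum-+ _ (λ p → δ k p * h k)) (cong (prefixSum (toℕ k) h +_) (sum-δ k h)))
  where
  pointwise : ∀ p → ⟦ toℕ p < suc (toℕ k) ⟧ * h p ≡ ⟦ toℕ p < toℕ k ⟧ * h p + δ k p * h k
  pointwise p with p ≟ᶠ k
  ... | yes refl rewrite ⟦<⟧-yes (n<1+n (toℕ p)) | ⟦<⟧-no {toℕ p} {toℕ p} ≤-refl = refl
  ... | no p≢k = trans (cong (_* h p) (⟦<⟧-cong (λ l → ≤∧≢⇒< (s≤s⁻¹ l) (p≢k ∘ toℕ-injective)) m<n⇒m<1+n)) (sym (+-identityʳ _))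

prefixSum-swap : ∀ {n} m {i j : Fin n} → toℕ i < toℕ j → (h : Fin n → ℕ) →
  prefixSum m (h ∘ swapF i j) + window (toℕ i) (toℕ j) m * h i ≡ prefixSum m h + window (toℕ i) (toℕ j) m * h j
prefixSum-swap {n} m {i} {j} i<j h
  rewrite sum-split (toℕ-<⇒≢ i<j) (λ p → ⟦ toℕ p < m ⟧ * h (swapF i j p)) | sum-split (toℕ-<⇒≢ i<j) (λ p → ⟦ toℕ p < m ⟧ * h p)
        | swapF-left i j | swapF-right i j
        | sum-cong (off-cong {i = i} {j} λ p p≢i p≢j → cong (λ q → ⟦ toℕ p < m ⟧ * h q) (swapF-off p≢i p≢j))
  = go (sum (λ p → off i j p * (⟦ toℕ p < m ⟧ * h p)))
  where
  go : ∀ R → ⟦ toℕ i < m ⟧ * h j + ⟦ toℕ j < m ⟧ * h i + R + window (toℕ i) (toℕ j) m * h i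
    ≡ ⟦ toℕ i < m ⟧ * h i + ⟦ toℕ j < m ⟧ * h j + R + window (toℕ i) (toℕ j) m * h j
  go R with cmp (toℕ j) m
  ... | less j<m e e' rewrite e | e' | ⟦<⟧-yes (<-trans i<j j<m) = lemma (h i) (h j) R
    where
    lemma : ∀ x y R → 1 * y + 1 * x + R + 1 * 0 * x ≡ 1 * x + 1 * y + R + 1 * 0 * y
    lemma = solve-∀
  ... | geq m≤j e e' rewrite e | e' = lemma ⟦ toℕ i < m ⟧ (h i) (h j) R
    where
    lemma : ∀ t x y R → t * y + 0 * x + R + t * 1 * x ≡ t * x + 0 * y + R + t * 1 * y
    lemma = solve-∀

-- Counting the affected prefix lengths; the `j - i` in the definition of a quantum edge enters the
-- distance formula here.
sum-window : ∀ {n i j} → i < j → j < n → sum {n} (λ m → window i j (toℕ m)) ≡ j ∸ i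
sum-window {n} {i} {j} i<j j<n = begin
  sum W ≡⟨ sym (m+n∸n≡m (sum W) (suc i)) ⟩
  sum W + suc i ∸ suc i ≡⟨ cong (λ x → sum W + x ∸ suc i) (sym (sum-threshold {n} (suc i) (<-trans i<j j<n))) ⟩
  sum W + sum {n} (λ m → ⟦ toℕ m < suc i ⟧) ∸ suc i ≡⟨ cong (_∸ suc i) (sym (sum-+ W _)) ⟩
  sum (λ m → W m + ⟦ toℕ m < suc i ⟧) ∸ suc i ≡⟨ cong (_∸ suc i) (sum-cong pointwise) ⟩
  sum {n} (λ m → ⟦ toℕ m < suc j ⟧) ∸ suc i ≡⟨ cong (_∸ suc i) (sum-threshold {n} (suc j) j<n) ⟩
  j ∸ i ∎
  where
  open ≡-Reasoning
  W : Fin n → ℕ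
  W m = window i j (toℕ m)
  pointwise : ∀ m → W m + ⟦ toℕ m < suc i ⟧ ≡ ⟦ toℕ m < suc j ⟧
  pointwise m with cmp i (toℕ m)
  ... | less i<m e e' rewrite e | e' = lemma ⟦ toℕ m < suc j ⟧
    where
    lemma : ∀ x → 1 * x + 0 ≡ x
    lemma = solve-∀
  ... | geq m≤i e e' rewrite e | e' = sym (⟦<⟧-yes (s≤s (≤-trans m≤i (<⇒≤ i<j))))

below above : ∀ {n} → ℕ → Fun n → ℕ → ℕ
below m w b = prefixSum m (λ p → ⟦ toℕ (w p) < b ⟧)
above m w b = prefixSum m (λ p → ⟦ b < suc (toℕ (w p)) ⟧)

-- For m ≤ n this is m + e_m(b) with e_m as above; the shift by m avoids subtraction.
excess : ∀ {n} → ℕ → Fun n → Fun n → ℕ → ℕ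
excess m u v b = below m v b + above m u b

below+above : ∀ {n m} → m ≤ n → (w : Fun n) (b : ℕ) → below m w b + above m w b ≡ m
below+above {n} {m} m≤n w b = trans (sym (prefixSum-+ {n} m _ _))
  (trans (prefixSum-cong m λ p → ⟦<⟧-complement (toℕ (w p)) b) (prefixSum-one m≤n))

-- Additivity of `e_m`. The left side carries the shift twice, hence the extra `m` on the right.
excess-chain : ∀ {n m} → m ≤ n → (u w v : Fun n) (b : ℕ) → excess m u w b + excess m w v b ≡ excess m u v b + m
excess-chain {n} {m} m≤n u w v b =
  trans (lemma (below m w b) (above m u b) (below m v b) (above m w b)) (cong (excess m u v b +_) (below+above m≤n w b))
  where
  lemma : ∀ a b c d → (a + b) + (c + d) ≡ c + b + (a + d)
  lemma = solve-∀

excess-cong : ∀ {n} m {u u' v v' : Fun n} → u ≗ u' → v ≗ v' → ∀ b → excess m u v b ≡ excess m u' v' b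
excess-cong m eu ev b = cong₂ _+_ (prefixSum-cong m λ p → cong (λ x → ⟦ toℕ x < b ⟧) (ev p))
                                  (prefixSum-cong m λ p → cong (λ x → ⟦ b < suc (toℕ x) ⟧) (eu p))

-- Contribution of one position to the excess, equal to `1 + [v < b] - [u < b]`.
term : ℕ → ℕ → ℕ → ℕ
term u v b = ⟦ v < b ⟧ + ⟦ b < suc u ⟧

excess-term : ∀ {n} m (u v : Fun n) b → excess m u v b ≡ prefixSum m (λ p → term (toℕ (u p)) (toℕ (v p)) b)
excess-term m u v b = sym (prefixSum-+ m _ _)

-- At either end every term is 1. Cuts therefore live on a cycle, on which `n` and 0 are the same
-- cut.
excess-beyond : ∀ {n} m (u v : Fun n) {b} → n ≤ b → excess m u v b ≡ excess m u v 0
excess-beyond m u v {b} n≤b = trans (excess-term m u v b) (trans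
  (prefixSum-cong m λ p → trans
    (cong₂ _+_ (⟦<⟧-yes (<-≤-trans (toℕ<n (v p)) n≤b)) (⟦<⟧-no (<-≤-trans (toℕ<n (u p)) n≤b)))
    (sym (cong₂ _+_ (⟦<⟧-no {toℕ (v p)} z≤n) (⟦<⟧-yes {0} z<s))))
  (sym (excess-term m u v 0)))

argmax : ∀ N (f : ℕ → ℕ) → ∃ λ r → r ≤ N × (∀ b → b ≤ N → f b ≤ f r)
argmax zero f = 0 , z≤n , λ { zero z≤n → ≤-refl }
argmax (suc N) f with argmax N f
... | r , r≤N , max with f (suc N) ≤? f r
...   | yes l = r , ≤-trans r≤N (n≤1+n N) , λ b b≤ → bound b b≤
  where
  bound : ∀ b → b ≤ suc N → f b ≤ f r
  bound b b≤ with m≤n⇒m<n∨m≡n b≤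
  ... | inj₁ b<sN = max b (s≤s⁻¹ b<sN)
  ... | inj₂ refl = l
...   | no g = suc N , ≤-refl , λ b b≤ → bound b b≤
  where
  bound : ∀ b → b ≤ suc N → f b ≤ f (suc N)
  bound b b≤ with m≤n⇒m<n∨m≡n b≤
  ... | inj₁ b<sN = ≤-trans (max b (s≤s⁻¹ b<sN)) (<⇒≤ (≰⇒> g))
  ... | inj₂ refl = ≤-refl

-- m plus the exponent of q_m in the weight of a shortest path from u to v.
opaque
  D : ∀ {n} → ℕ → Fun n → Fun n → ℕ
  D {n} m u v = excess m u v (proj₁ (argmax n (excess m u v)))

  excess≤D : ∀ {n} m (u v : Fun n) b → excess m u v b ≤ D m u v
  excess≤D {n} m u v b with b ≤? n
  ... | yes b≤n = proj₂ (proj₂ (argmax n (excess m u v))) b b≤n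
  ... | no b≰n = ≤-trans (≤-reflexive (excess-beyond m u v (<⇒≤ (≰⇒> b≰n)))) (proj₂ (proj₂ (argmax n (excess m u v))) 0 z≤n)

  D-least : ∀ {n} m (u v : Fun n) {c} → (∀ b → excess m u v b ≤ c) → D m u v ≤ c
  D-least m u v bound = bound _

  -- A maximiser at `n` is replaced by the equivalent cut 0, so that it can serve as an entry of
  -- `a`. The argument of type `Fin n` provides `n > 0`.
  D-attained : ∀ {n} → Fin n → ∀ m (u v : Fun n) → Σ (Fin n) λ r → excess m u v (toℕ r) ≡ D m u v
  D-attained {suc n} _ m u v with argmax (suc n) (excess m u v)
  ... | r , r≤n , _ with m≤n⇒m<n∨m≡n r≤n
  ...   | inj₁ r<n = fromℕ< r<n , cong (excess m u v) (toℕ-fromℕ< r<n)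
  ...   | inj₂ refl = zero , sym (excess-beyond m u v ≤-refl)

totalD : ∀ {n} → Fun n → Fun n → ℕ
totalD {n} u v = sum (λ m → D (toℕ {suc n} m) u v)

-- Sum of the shifts over the lengths `0, ..., n`: `totalD u v` exceeds the sum of the maxima of the
-- `e_m` by this amount.
K : ℕ → ℕ
K n = sum {suc n} toℕ

-- At each cut the excess is additive, and the maximum of a sum is at most the sum of the maxima.
D-triangle : ∀ {n} {m} → m ≤ n → (u w v : Fun n) → D m u v + m ≤ D m u w + D m w v
D-triangle {n} {m} m≤n u w v = ≤-trans (+-monoˡ-≤ m (D-least m u v bound)) (≤-reflexive (m∸n+n≡m m≤sum))
  where
  step : ∀ b → excess m u v b + m ≤ D m u w + D m w v
  step b = ≤-trans (≤-reflexive (sym (excess-chain m≤n u w v b))) (+-mono-≤ (excess≤D m u w b) (excess≤D m w v b))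
  m≤sum : m ≤ D m u w + D m w v
  m≤sum = ≤-trans (m≤n+m m (excess m u v 0)) (step 0)
  bound : ∀ b → excess m u v b ≤ D m u w + D m w v ∸ m
  bound b = m+n≤o⇒m≤o∸n _ (step b)

totalD-triangle : ∀ {n} (u w v : Fun n) → totalD u v + K n ≤ totalD u w + totalD w v
totalD-triangle {n} u w v = ≤-trans (≤-reflexive (sym (sum-+ _ _)))
  (≤-trans (sum-mono _ _ λ m → D-triangle (s≤s⁻¹ (toℕ<n m)) u w v) (≤-reflexive (sum-+ _ _)))

-- The lower bound for path lengths

below-swap : ∀ {n} m {i j : Fin n} → toℕ i < toℕ j → (w : Fun n) (b : ℕ) →
  below m (w ∘ swapF i j) b + window (toℕ i) (toℕ j) m * ⟦ toℕ (w i) < b ⟧ ≡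
  below m w b + window (toℕ i) (toℕ j) m * ⟦ toℕ (w j) < b ⟧
below-swap m i<j w b = prefixSum-swap m i<j (λ p → ⟦ toℕ (w p) < b ⟧)

above-swap : ∀ {n} m {i j : Fin n} → toℕ i < toℕ j → (w : Fun n) (b : ℕ) →
  above m (w ∘ swapF i j) b + window (toℕ i) (toℕ j) m * ⟦ b < suc (toℕ (w i)) ⟧ ≡
  above m w b + window (toℕ i) (toℕ j) m * ⟦ b < suc (toℕ (w j)) ⟧
above-swap m i<j w b = prefixSum-swap m i<j (λ p → ⟦ b < suc (toℕ (w p)) ⟧)

excess-transposition : ∀ {n m} → m ≤ n → {i j : Fin n} → toℕ i < toℕ j → (w : Fun n) (b : ℕ) →
  excess m w (w ∘ swapF i j) b + window (toℕ i) (toℕ j) m * ⟦ toℕ (w i) < b ⟧ ≡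
  m + window (toℕ i) (toℕ j) m * ⟦ toℕ (w j) < b ⟧
excess-transposition {n} {m} m≤n {i} {j} i<j w b = begin
  below m w' b + above m w b + ω * ⟦ toℕ (w i) < b ⟧ ≡⟨ lemma (below m w' b) (above m w b) _ ⟩
  above m w b + (below m w' b + ω * ⟦ toℕ (w i) < b ⟧) ≡⟨ cong (above m w b +_) (below-swap m i<j w b) ⟩
  above m w b + (below m w b + ω * ⟦ toℕ (w j) < b ⟧) ≡⟨ lemma₂ (above m w b) (below m w b) _ ⟩
  below m w b + above m w b + ω * ⟦ toℕ (w j) < b ⟧ ≡⟨ cong (_+ ω * ⟦ toℕ (w j) < b ⟧) (below+above m≤n w b) ⟩
  m + ω * ⟦ toℕ (w j) < b ⟧ ∎
  where
  open ≡-Reasoning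
  w' : Fun n
  w' = w ∘ swapF i j
  ω : ℕ
  ω = window (toℕ i) (toℕ j) m
  lemma : ∀ a b c → a + b + c ≡ b + (a + c)
  lemma = solve-∀
  lemma₂ : ∀ a b c → a + (b + c) ≡ b + a + c
  lemma₂ = solve-∀

D-transposition : ∀ {n m} → m ≤ n → {i j : Fin n} → toℕ i < toℕ j → {w z : Fun n} → z ≗ w ∘ swapF i j →
  D m w z ≤ m + window (toℕ i) (toℕ j) m
D-transposition {n} {m} m≤n {i} {j} i<j {w} {z} z≗ = D-least m w z λ b → begin
  excess m w z b ≡⟨ excess-cong m (λ _ → refl) z≗ b ⟩
  excess m w (w ∘ swapF i j) b ≤⟨ m≤m+n _ _ ⟩
  excess m w (w ∘ swapF i j) b + ω * ⟦ toℕ (w i) < b ⟧ ≡⟨ excess-transposition m≤n i<j w b ⟩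
  m + ω * ⟦ toℕ (w j) < b ⟧ ≤⟨ +-monoʳ-≤ m (*-monoʳ-≤ ω (⟦<⟧≤1 (toℕ (w j)) b)) ⟩
  m + ω * 1 ≡⟨ cong (m +_) (*-identityʳ ω) ⟩
  m + ω ∎
  where
  open ≤-Reasoning
  ω : ℕ
  ω = window (toℕ i) (toℕ j) m

-- From `w` to the exchanged permutation, `e_m(b)` is `[w j < b] - [w i < b]` on the window and 0
-- elsewhere, which is never positive when `w i < w j`. A Bruhat edge thus costs no `q`.
D-ascent : ∀ {n m} → m ≤ n → {i j : Fin n} → toℕ i < toℕ j → {w z : Fun n} → z ≗ w ∘ swapF i j →
  toℕ (w i) < toℕ (w j) → D m w z ≤ m
D-ascent {n} {m} m≤n {i} {j} i<j {w} {z} z≗ a<c = D-least m w z λ b → begin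
  excess m w z b ≡⟨ excess-cong m (λ _ → refl) z≗ b ⟩
  excess m w (w ∘ swapF i j) b ≤⟨ +-cancelʳ-≤ (ω * ⟦ toℕ (w i) < b ⟧) _ _
     (≤-trans (≤-reflexive (excess-transposition m≤n i<j w b))
       (+-monoʳ-≤ m (*-monoʳ-≤ ω (⟦<⟧-mono {toℕ (w j)} {b} (<-trans a<c))))) ⟩
  m ∎
  where
  open ≤-Reasoning
  ω : ℕ
  ω = window (toℕ i) (toℕ j) m

inv-descent : ∀ {n} {w : Fun n} → IsPerm w → ∀ {i j} → toℕ i < toℕ j → toℕ (w j) < toℕ (w i) →
  inv w ≡ 1 + inv (w ∘ swapF i j) + 2 * sum (between (w ∘ swapF i j) i j)
inv-descent {w = w} w-perm {i} {j} i<j c<a = trans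
  (inv-cong λ p → cong w (sym (swapF-involutive i j p)))
  (inv-swap (swapF-perm i j w-perm) i<j
    (subst₂ (λ x y → toℕ x < toℕ y) (cong w (sym (swapF-left i j))) (cong w (sym (swapF-right i j))) c<a))

-- A Bruhat edge gains one inversion and has no exponents. A quantum edge loses `2(j-i) - 1`
-- inversions, while its exponents are at most 1 on `j - i` lengths, so the balance again grows by
-- at most one.
edge-bound : ∀ {n} {x z : Fun n} → IsPerm x → QEdge x z → inv z + 2 * totalD x z ≤ 1 + (inv x + 2 * K n)
edge-bound {n} {x} {z} x-perm (i , j , i<j , z≗ , inj₂ down) = begin
  inv z + 2 * totalD x z ≤⟨ +-mono-≤ (≤-reflexive (inv-cong z≗)) (*-monoʳ-≤ 2 total) ⟩
  inv x' + 2 * (K n + (toℕ j ∸ toℕ i)) ≡⟨ lemma (inv x') (K n) (toℕ j ∸ toℕ i) ⟩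
  inv x' + 2 * (toℕ j ∸ toℕ i) + 2 * K n ≡⟨ cong (_+ 2 * K n) down ⟩
  1 + (inv x + 2 * K n) ∎
  where
  open ≤-Reasoning
  x' : Fun n
  x' = x ∘ swapF i j
  lemma : ∀ a b c → a + 2 * (b + c) ≡ a + 2 * c + 2 * b
  lemma = solve-∀
  total : totalD x z ≤ K n + (toℕ j ∸ toℕ i)
  total = ≤-trans (sum-mono _ _ λ m → D-transposition (s≤s⁻¹ (toℕ<n m)) i<j z≗)
    (≤-reflexive (trans (sum-+ _ _) (cong (K n +_) (sum-window i<j (m<n⇒m<1+n (toℕ<n j))))))
edge-bound {n} {x} {z} x-perm (i , j , i<j , z≗ , inj₁ up) with cmp (toℕ (x i)) (toℕ (x j))
... | less a<c _ _ = +-mono-≤ (≤-reflexive (trans (inv-cong z≗) up))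
        (*-monoʳ-≤ 2 (sum-mono _ _ λ m → D-ascent (s≤s⁻¹ (toℕ<n m)) i<j z≗ a<c))
-- Exchanging a descent lowers the number of inversions, which contradicts `up`.
... | geq c≤a _ _ = contradiction (≤-reflexive (sym descent)) (<⇒≱ (≤-trans (s≤s (n≤1+n _)) (s≤s (m≤m+n _ _))))
  where
  descent : inv x ≡ 1 + suc (inv x) + 2 * sum (between (x ∘ swapF i j) i j)
  descent = subst (λ t → inv x ≡ 1 + t + 2 * sum (between (x ∘ swapF i j) i j)) up
    (inv-descent x-perm i<j (≤∧≢⇒< c≤a (perm-≢ x-perm (toℕ-<⇒≢ i<j ∘ sym))))

edge-perm : ∀ {n} {x z : Fun n} → IsPerm x → QEdge x z → IsPerm z
edge-perm x-perm (i , j , _ , z≗ , _) = perm-cong z≗ (swapF-perm i j x-perm)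

path-bound : ∀ {n} {x y : Fun n} {d} → IsPerm x → QPath x y d → inv y + 2 * totalD x y ≤ d + (inv x + 2 * K n)
path-bound {n} {x} {y} x-perm (here x≗y) = +-mono-≤ (≤-reflexive (inv-cong (sym ∘ x≗y)))
  (*-monoʳ-≤ 2 (sum-mono _ _ λ m → D-least (toℕ m) x y λ b →
    ≤-reflexive (trans (excess-cong (toℕ m) x≗y (λ _ → refl) b) (below+above (s≤s⁻¹ (toℕ<n m)) y b))))
path-bound {n} {x} {y} x-perm (there {z = z} {d = d} e π) = linear
  (+-mono-≤ (+-mono-≤ (edge-bound x-perm e) (path-bound (edge-perm x-perm e) π)) (*-monoʳ-≤ 2 (totalD-triangle x z y)))
  (lemma (inv x) (inv y) (inv z) (K n) d (totalD x y) (totalD x z) (totalD z y))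
  where
  lemma : ∀ ix iy iz k d xy xz zy →
    iy + 2 * xy + (1 + (ix + 2 * k) + (d + (iz + 2 * k)) + 2 * (xz + zy)) ≡
    1 + d + (ix + 2 * k) + (iz + 2 * xz + (iy + 2 * zy) + 2 * (xy + k))
  lemma = solve-∀

-- A shortest path

least : ∀ {n} {P : Fin n → Set} → (∀ p → Dec (P p)) → ∃ P → ∃ λ j → P j × (∀ p → toℕ p < toℕ j → ¬ P p)
least {suc n} P? (q , Pq) with P? zero
... | yes P0 = zero , P0 , λ p ()
least {suc n} P? (zero , Pq) | no ¬P0 = contradiction Pq ¬P0
least {suc n} {P} P? (suc q , Pq) | no ¬P0 with least (P? ∘ suc) (q , Pq)
... | j , Pj , min = suc j , Pj , min'
  where
  min' : ∀ p → toℕ p < suc (toℕ j) → ¬ P p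
  min' zero _ = ¬P0
  min' (suc p) l = min p (s≤s⁻¹ l)

perm-surjective : ∀ {n} {w : Fun n} → IsPerm w → ∀ y → ∃ λ q → w q ≡ y
perm-surjective {suc n} {w} w-perm y with any? (λ q → w q ≟ᶠ y)
... | yes found = found
... | no missing = contradiction (λ {p} {q} e → w-perm p q (punchOut-injective (avoids p) (avoids q) e)) (<⇒notInjective (n<1+n n))
  where
  avoids : ∀ p → y ≢ w p
  avoids p e = missing (p , sym e)

-- The value u lies outside the cyclic interval from b to y (inclusive).
Avoids : ℕ → ℕ → ℕ → Set
Avoids b y u = (b ≤ y × (u < b ⊎ y < u)) ⊎ (y < u × u < b)

term-cases : ∀ {u v b u' v' c : ℕ} → (v < b → v' < c) → (b < suc u → c < suc u') → term u v b ≤ ⟦ v' < c ⟧ + ⟦ c < suc u' ⟧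
term-cases {u} {v} {b} f g = +-mono-≤ (⟦<⟧-mono {v} {b} f) (⟦<⟧-mono {b} {suc u} g)

-- As the cut moves cyclically forward from `b` to just past `y`, the term can drop only on passing
-- the value `u`, and `u` is not on the way.
avoids-term : ∀ {b y u} → Avoids b y u → ∀ v → term u v b ≤ term u v (suc y)
avoids-term {b} {y} {u} (inj₁ (b≤y , inj₁ u<b)) v =
  term-cases {u} {v} {b} {u} (λ v<b → ≤-trans v<b (≤-trans b≤y (n≤1+n y))) (λ b<su → contradiction u<b (<⇒≱ b<su))
avoids-term {b} {y} {u} (inj₁ (b≤y , inj₂ y<u)) v =
  term-cases {u} {v} {b} {u} (λ v<b → ≤-trans v<b (≤-trans b≤y (n≤1+n y))) (λ _ → s≤s y<u)
avoids-term {b} {y} {u} (inj₂ (y<u , u<b)) v = ≤-trans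
  (+-mono-≤ (⟦<⟧≤1 v b) (≤-reflexive (⟦<⟧-no {b} u<b)))
  (≤-trans (≤-reflexive (sym (⟦<⟧-yes {suc y} {suc u} (s≤s y<u)))) (m≤n+m _ _))

avoids-term-strict : ∀ {b y u} → Avoids b y u → term u y b < term u y (suc y)
avoids-term-strict {b} {y} {u} (inj₁ (b≤y , inj₁ u<b))
  rewrite ⟦<⟧-no b≤y | ⟦<⟧-no {b} {suc u} u<b | ⟦<⟧-yes (n<1+n y) = s≤s z≤n
avoids-term-strict {b} {y} {u} (inj₁ (b≤y , inj₂ y<u))
  rewrite ⟦<⟧-no b≤y | ⟦<⟧-yes {b} {suc u} (s≤s (≤-trans b≤y (<⇒≤ y<u))) | ⟦<⟧-yes (n<1+n y) | ⟦<⟧-yes {suc y} {suc u} (s≤s y<u) = ≤-refl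
avoids-term-strict {b} {y} {u} (inj₂ (y<u , u<b))
  rewrite ⟦<⟧-no {b} {suc u} u<b | ⟦<⟧-yes (<-trans y<u u<b) | ⟦<⟧-yes (n<1+n y) | ⟦<⟧-yes {suc y} {suc u} (s≤s y<u) = ≤-refl

-- Positions before `k` contribute 1 at every cut, later ones lose nothing, and position `k` gains
-- because the cut passes `v k`. Hence `b` is not a maximiser, which leaves room for the unit that
-- `D-step` has to pay there.
excess-increases : ∀ {n} m {u v : Fun n} (k : Fin n) → toℕ k < m → (∀ p → toℕ p < toℕ k → u p ≡ v p) →
  ∀ {b} → (∀ p → toℕ k ≤ toℕ p → toℕ p < m → Avoids b (toℕ (v k)) (toℕ (u p))) →
  excess m u v b < excess m u v (suc (toℕ (v k)))
excess-increases {n} m {u} {v} k k<m agree {b} avoid =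
  subst₂ _<_ (sym (excess-term m u v b)) (sym (excess-term m u v (suc (toℕ (v k)))))
    (sum-mono-strict _ _ pointwise k strict)
  where
  c : ℕ
  c = suc (toℕ (v k))
  pointwise : ∀ p → ⟦ toℕ p < m ⟧ * term (toℕ (u p)) (toℕ (v p)) b ≤ ⟦ toℕ p < m ⟧ * term (toℕ (u p)) (toℕ (v p)) c
  pointwise p with cmp (toℕ p) m
  ... | geq _ e _ rewrite e = z≤n
  ... | less p<m _ _ with toℕ k ≤? toℕ p
  ...   | yes k≤p = *-monoʳ-≤ ⟦ toℕ p < m ⟧ (avoids-term (avoid p k≤p p<m) (toℕ (v p)))
  ...   | no k≰p rewrite agree p (≰⇒> k≰p) = ≤-reflexive (cong (⟦ toℕ p < m ⟧ *_)
            (trans (⟦<⟧-complement (toℕ (v p)) b) (sym (⟦<⟧-complement (toℕ (v p)) c))))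
  strict : ⟦ toℕ k < m ⟧ * term (toℕ (u k)) (toℕ (v k)) b < ⟦ toℕ k < m ⟧ * term (toℕ (u k)) (toℕ (v k)) c
  strict rewrite ⟦<⟧-yes k<m = +-monoˡ-< 0 (avoids-term-strict (avoid k ≤-refl k<m))

-- b lies in the cyclic interval from x (exclusive) to y (inclusive), for x ≢ y.
Arc : ℕ → ℕ → ℕ → Set
Arc x y b = (x < b × b ≤ y) ⊎ (y < x × (x < b ⊎ b ≤ y))

-- Moving `y` into a prefix in place of `x` changes the excess at `b` by `[b ≤ y] - [b ≤ x]`, and
-- `[y < x]` is the exponent spent by the edge. Together they amount to at most 1 on the arc and at
-- most 0 off it.
arc-count : ∀ x y b → ¬ (x ≡ y) →
  (Arc x y b × ⟦ b < suc y ⟧ + ⟦ y < x ⟧ ≤ 1 + ⟦ b < suc x ⟧) ⊎ (⟦ b < suc y ⟧ + ⟦ y < x ⟧ ≤ ⟦ b < suc x ⟧)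
arc-count x y b x≢y with cmp x b | cmp y b | cmp y x
... | less x<b _ e | less y<b _ e' | less y<x e'' _ rewrite e | e' | e'' = inj₁ (inj₂ (y<x , inj₁ x<b) , ≤-refl)
... | less x<b _ e | less y<b _ e' | geq x≤y e'' _ rewrite e | e' | e'' = inj₂ z≤n
... | less x<b _ e | geq b≤y _ e' | less y<x e'' _ = contradiction (<-≤-trans x<b b≤y) (<⇒≯ y<x)
... | less x<b _ e | geq b≤y _ e' | geq x≤y e'' _ rewrite e | e' | e'' = inj₁ (inj₁ (x<b , b≤y) , ≤-refl)
... | geq b≤x _ e | less y<b _ e' | less y<x e'' _ rewrite e | e' | e'' = inj₂ ≤-refl
... | geq b≤x _ e | less y<b _ e' | geq x≤y e'' _ = contradiction (≤-trans b≤x x≤y) (<⇒≱ y<b)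
... | geq b≤x _ e | geq b≤y _ e' | less y<x e'' _ rewrite e | e' | e'' = inj₁ (inj₂ (y<x , inj₂ b≤y) , ≤-refl)
... | geq b≤x _ e | geq b≤y _ e' | geq x≤y e'' _ rewrite e | e' | e'' = inj₂ ≤-refl

excess-swap-left : ∀ {n} m {i j : Fin n} → toℕ i < toℕ j → (u v : Fun n) (b : ℕ) →
  excess m (u ∘ swapF i j) v b + window (toℕ i) (toℕ j) m * ⟦ b < suc (toℕ (u i)) ⟧ ≡
  excess m u v b + window (toℕ i) (toℕ j) m * ⟦ b < suc (toℕ (u j)) ⟧
excess-swap-left m {i} {j} i<j u v b = trans (+-assoc (below m v b) _ _)
  (trans (cong (below m v b +_) (above-swap m i<j u b)) (sym (+-assoc (below m v b) _ _)))

-- Outside the window nothing changes. Inside it, a cut off the arc does not rise, and a cut on the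
-- arc rises by at most one from a value that `excess-increases` places below the maximum.
D-step : ∀ {n} m {u v : Fun n} {k j : Fin n} → toℕ k < toℕ j → ¬ (toℕ (u k) ≡ toℕ (u j)) →
  (∀ p → toℕ p < toℕ k → u p ≡ v p) →
  (∀ b → Arc (toℕ (u k)) (toℕ (u j)) b → ∀ p → toℕ k ≤ toℕ p → toℕ p < toℕ j → Avoids b (toℕ (v k)) (toℕ (u p))) →
  D m (u ∘ swapF k j) v + window (toℕ k) (toℕ j) m * ⟦ toℕ (u j) < toℕ (u k) ⟧ ≤ D m u v
D-step {n} m {u} {v} {k} {j} k<j uk≢uj agree avoid = D-bound
  where
  x y ω A : ℕ
  x = toℕ (u k)
  y = toℕ (u j)
  ω = window (toℕ k) (toℕ j) m
  A = ⟦ y < x ⟧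
  z : Fun n
  z = u ∘ swapF k j
  outside : ω ≡ 0 → ∀ b → excess m z v b + ω * A ≤ D m u v
  outside ω≡0 b with excess-swap-left m k<j u v b
  ... | eq rewrite ω≡0 = ≤-trans (≤-reflexive eq) (≤-trans (≤-reflexive (+-identityʳ (excess m u v b))) (excess≤D m u v b))
  inside : ω ≡ 1 → toℕ k < m → m ≤ toℕ j → ∀ b → excess m z v b + ω * A ≤ D m u v
  inside ω≡1 k<m m≤j b with excess-swap-left m k<j u v b | arc-count x y b uk≢uj
  ... | eq | inj₂ h rewrite ω≡1 = linear
    (+-mono-≤ (+-mono-≤ (≤-reflexive eq) h) (excess≤D m u v b))
    (lemma (excess m z v b) (excess m u v b) ⟦ b < suc x ⟧ ⟦ b < suc y ⟧ A (D m u v))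
    where
    lemma : ∀ Z U B C A d → Z + 1 * A + (U + 1 * C + B + d) ≡ d + (Z + 1 * B + (C + A) + U)
    lemma = solve-∀
  ... | eq | inj₁ (arc , h) rewrite ω≡1 = linear
    (+-mono-≤ (+-mono-≤ (≤-reflexive eq) h)
      (≤-trans (excess-increases m k k<m agree (λ p k≤p p<m → avoid b arc p k≤p (<-≤-trans p<m m≤j))) (excess≤D m u v _)))
    (lemma (excess m z v b) (excess m u v b) ⟦ b < suc x ⟧ ⟦ b < suc y ⟧ A (D m u v))
    where
    lemma : ∀ Z U B C A d → Z + 1 * A + (U + 1 * C + (1 + B) + d) ≡ d + (Z + 1 * B + (C + A) + suc U)
    lemma = solve-∀
  step : ∀ b → excess m z v b + ω * A ≤ D m u v
  step with cmp (toℕ k) m | cmp (toℕ j) m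
  ... | geq m≤k e _ | _ = outside (cong (_* ⟦ m < suc (toℕ j) ⟧) e)
  ... | less _ e _ | less _ _ e' = outside (cong₂ _*_ e e')
  ... | less k<m e _ | geq m≤j _ e' = inside (cong₂ _*_ e e') k<m m≤j
  D-bound : D m z v + ω * A ≤ D m u v
  D-bound = ≤-trans
    (+-monoˡ-≤ (ω * A) (D-least m z v λ b → m+n≤o⇒m≤o∸n _ (step b)))
    (≤-reflexive (m∸n+n≡m (≤-trans (m≤n+m (ω * A) (excess m z v 0)) (step 0))))

-- The distance to v given by the formula drops by one along some edge.
Progress : ∀ {n} → Fun n → Fun n → Set
Progress {n} u v = Σ (Fun n) λ z → QEdge u z × 1 + inv u + 2 * totalD z v ≤ inv z + 2 * totalD u v

between-zero : ∀ {n} (w : Fun n) i j →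
  (∀ p → toℕ i < toℕ p → toℕ p < toℕ j → toℕ (w i) < toℕ (w p) → toℕ (w p) < toℕ (w j) → ⊥) → sum (between w i j) ≡ 0
between-zero w i j none = sum-zero _ pointwise
  where
  pointwise : ∀ p → between w i j p ≡ 0
  pointwise p with cmp (toℕ i) (toℕ p) | cmp (toℕ p) (toℕ j) | cmp (toℕ (w i)) (toℕ (w p)) | cmp (toℕ (w p)) (toℕ (w j))
  ... | geq _ e _ | _ | _ | _ rewrite e = refl
  ... | less _ e _ | geq _ e' _ | _ | _ rewrite e | e' = refl
  ... | less _ e _ | less _ e' _ | geq _ e'' _ | _ rewrite e | e' | e'' = refl
  ... | less _ e _ | less _ e' _ | less _ e'' _ | geq _ e''' _ rewrite e | e' | e'' | e''' = refl
  ... | less i<p _ _ | less p<j _ _ | less a<x _ _ | less x<c _ _ = ⊥-elim (none p i<p p<j a<x x<c)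

between-all : ∀ {n} (w : Fun n) {i j} → toℕ i < toℕ j →
  (∀ p → toℕ i < toℕ p → toℕ p < toℕ j → toℕ (w i) < toℕ (w p) × toℕ (w p) < toℕ (w j)) →
  1 + sum (between w i j) ≡ toℕ j ∸ toℕ i
between-all {n} w {i} {j} i<j all = begin
  1 + sum (between w i j) ≡⟨ +-comm 1 _ ⟩
  -- The extra 1 stands for the position `j`, which belongs to the window but not to the open
  -- interval.
  sum (between w i j) + 1 ≡⟨ cong (sum (between w i j) +_) (sym (sum-δ j (λ _ → 1))) ⟩
  sum (between w i j) + sum (λ p → δ j p * 1) ≡⟨ sym (sum-+ (between w i j) _) ⟩
  sum (λ p → between w i j p + δ j p * 1) ≡⟨ sum-cong pointwise ⟩
  sum {n} (λ m → window (toℕ i) (toℕ j) (toℕ m)) ≡⟨ sum-window i<j (toℕ<n j) ⟩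
  toℕ j ∸ toℕ i ∎
  where
  open ≡-Reasoning
  pointwise : ∀ p → between w i j p + δ j p * 1 ≡ window (toℕ i) (toℕ j) (toℕ p)
  pointwise p with cmp (toℕ i) (toℕ p) | p ≟ᶠ j
  ... | less i<p e _ | yes refl rewrite e | ⟦<⟧-no {toℕ p} {toℕ p} ≤-refl | ⟦<⟧-yes (n<1+n (toℕ p)) = refl
  ... | geq p≤i e _ | yes refl = contradiction p≤i (<⇒≱ i<j)
  ... | geq p≤i e _ | no _ rewrite e = refl
  ... | less i<p e _ | no p≢j with cmp (toℕ p) (toℕ j)
  ...   | geq j≤p e' _ rewrite e | e' | ⟦<⟧-no {toℕ p} {suc (toℕ j)} (≤∧≢⇒< j≤p (p≢j ∘ sym ∘ toℕ-injective)) = refl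
  ...   | less p<j e' _ rewrite e | e' | ⟦<⟧-yes (m<n⇒m<1+n p<j) | ⟦<⟧-yes (proj₁ (all p i<p p<j)) | ⟦<⟧-yes (proj₂ (all p i<p p<j)) = refl

module _ {n} {u v : Fun n} (u-perm : IsPerm u) {k j : Fin n} (k<j : toℕ k < toℕ j)
  (agree : ∀ p → toℕ p < toℕ k → u p ≡ v p)
  (avoid : ∀ b → Arc (toℕ (u k)) (toℕ (u j)) b → ∀ p → toℕ k ≤ toℕ p → toℕ p < toℕ j → Avoids b (toℕ (v k)) (toℕ (u p)))
  where

  private
    z : Fun n
    z = u ∘ swapF k j
    k≢j : k ≢ j
    k≢j = toℕ-<⇒≢ k<j

  -- The empty rectangle makes the exchange a Bruhat edge.
  progress-up : toℕ (u k) < toℕ (u j) →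
    (∀ p → toℕ k < toℕ p → toℕ p < toℕ j → toℕ (u k) < toℕ (u p) → toℕ (u p) < toℕ (u j) → ⊥) → Progress u v
  progress-up a<c none = z , (k , j , k<j , (λ _ → refl) , inj₁ inv-z) ,
    +-mono-≤ (≤-reflexive (sym inv-z)) (*-monoʳ-≤ 2 (sum-mono _ _ λ m →
      ≤-trans (m≤m+n _ _) (D-step (toℕ m) k<j (perm-≢ u-perm k≢j) agree avoid)))
    where
    inv-z : inv z ≡ suc (inv u)
    inv-z = trans (inv-swap u-perm k<j a<c) (trans (cong (λ x → 1 + inv u + 2 * x) (between-zero u k j none)) (+-identityʳ _))

  -- All intermediate positions lie in the rectangle, so the length drops by the largest possible
  -- amount `2(j-k) - 1` and the exchange is a quantum edge.
  progress-down : toℕ (u j) < toℕ (u k) →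
    (∀ p → toℕ k < toℕ p → toℕ p < toℕ j → toℕ (u j) < toℕ (u p) × toℕ (u p) < toℕ (u k)) → Progress u v
  progress-down c<a all = z , (k , j , k<j , (λ _ → refl) , inj₂ inv-z) , linear
    (+-mono-≤ (≤-reflexive (sym inv-z)) (*-monoʳ-≤ 2 total))
    (lemma (inv u) (inv z) (totalD z v) (totalD u v) (toℕ j ∸ toℕ k))
    where
    lemma : ∀ u z Z U d → 1 + u + 2 * Z + (z + 2 * d + 2 * U) ≡ z + 2 * U + (suc u + 2 * (Z + d))
    lemma = solve-∀
    ends : ∀ p → toℕ k < toℕ p → toℕ p < toℕ j → toℕ (z k) < toℕ (z p) × toℕ (z p) < toℕ (z j)
    ends p k<p p<j rewrite swapF-left k j | swapF-right k j | swapF-off {i = k} {j} (toℕ-<⇒≢ k<p ∘ sym) (toℕ-<⇒≢ p<j) = all p k<p p<j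
    inv-z : inv z + 2 * (toℕ j ∸ toℕ k) ≡ suc (inv u)
    inv-z = begin
      inv z + 2 * (toℕ j ∸ toℕ k) ≡⟨ cong (λ x → inv z + 2 * x) (sym (between-all z k<j ends)) ⟩
      inv z + 2 * (1 + sum (between z k j)) ≡⟨ rearrange (inv z) (sum (between z k j)) ⟩
      suc (1 + inv z + 2 * sum (between z k j)) ≡⟨ cong suc (sym (inv-descent u-perm k<j c<a)) ⟩
      suc (inv u) ∎
      where
      open ≡-Reasoning
      rearrange : ∀ a b → a + 2 * (1 + b) ≡ suc (1 + a + 2 * b)
      rearrange = solve-∀
    total : totalD z v + (toℕ j ∸ toℕ k) ≤ totalD u v
    total = ≤-trans (≤-reflexive (trans (cong (totalD z v +_) (sym (sum-window k<j (m<n⇒m<1+n (toℕ<n j))))) (sym (sum-+ (λ m → D (toℕ m) z v) _))))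
      (sum-mono _ _ λ m → ≤-trans
        (≤-reflexive (cong (D (toℕ m) z v +_) (trans (sym (*-identityʳ (window (toℕ k) (toℕ j) (toℕ m))))
          (cong (window (toℕ k) (toℕ j) (toℕ m) *_) (sym (⟦<⟧-yes c<a))))))
        (D-step (toℕ m) k<j (perm-≢ u-perm k≢j) agree avoid))

arc? : ∀ x y b → Dec (Arc x y b)
arc? x y b = ((x <? b) ×-dec (b ≤? y)) ⊎-dec ((y <? x) ×-dec ((x <? b) ⊎-dec (b ≤? y)))

-- Exchange the first entry u_k ≠ v_k with the next entry that lies cyclically between u_k and v_k.
progress : ∀ {n} {u v : Fun n} → IsPerm u → (k : Fin n) → (∀ p → toℕ p < toℕ k → u p ≡ v p) →
  IsPerm v → u k ≢ v k → Progress u v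
progress {n} {u} {v} u-perm k agree v-perm uk≢vk
  -- The position `q` of the value `v k` in `u` lies to the right of `k`, because the earlier
  -- entries of `u` and `v` agree; so the search for `j` has a candidate.
  with perm-surjective u-perm (v k)
... | q , uq≡vk with least {P = λ j → toℕ k < toℕ j × Arc (toℕ (u k)) (toℕ (v k)) (toℕ (u j))}
                      (λ j → (toℕ k <? toℕ j) ×-dec arc? (toℕ (u k)) (toℕ (v k)) (toℕ (u j)))
                      (q , k<q , subst (λ y → Arc (toℕ (u k)) (toℕ (v k)) (toℕ y)) (sym uq≡vk) target)
  where
  k<q : toℕ k < toℕ q
  k<q with <-cmp (toℕ k) (toℕ q)
  ... | tri< l _ _ = l
  ... | tri≈ _ e _ = contradiction (trans (cong u (toℕ-injective e)) uq≡vk) uk≢vk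
  ... | tri> _ _ g = contradiction (sym (v-perm q k (trans (sym (agree q g)) uq≡vk))) (toℕ-<⇒≢ g ∘ sym)
  target : Arc (toℕ (u k)) (toℕ (v k)) (toℕ (v k))
  target with <-cmp (toℕ (u k)) (toℕ (v k))
  ... | tri< l _ _ = inj₁ (l , ≤-refl)
  ... | tri≈ _ e _ = contradiction (toℕ-injective e) uk≢vk
  ... | tri> _ _ g = inj₂ (g , inj₂ ≤-refl)
... | j , (k<j , inj₁ (x<uj , uj≤y)) , min = progress-up u-perm k<j agree avoid x<uj
      λ p k<p p<j x<up up<uj → min p p<j (k<p , inj₁ (x<up , ≤-trans (<⇒≤ up<uj) uj≤y))
  where
  avoid : ∀ b → Arc (toℕ (u k)) (toℕ (u j)) b → ∀ p → toℕ k ≤ toℕ p → toℕ p < toℕ j → Avoids b (toℕ (v k)) (toℕ (u p))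
  avoid b (inj₂ (uj<x , _)) = contradiction uj<x (<⇒≯ x<uj)
  avoid b (inj₁ (x<b , b≤uj)) p k≤p p<j with m≤n⇒m<n∨m≡n k≤p
  ... | inj₂ e rewrite toℕ-injective e = inj₁ (≤-trans b≤uj uj≤y , inj₁ x<b)
  ... | inj₁ k<p with toℕ (u p) <? b
  ...   | yes up<b = inj₁ (≤-trans b≤uj uj≤y , inj₁ up<b)
  ...   | no up≮b = inj₁ (≤-trans b≤uj uj≤y , inj₂ (≰⇒> λ up≤y → min p p<j (k<p , inj₁ (<-≤-trans x<b (≮⇒≥ up≮b) , up≤y))))
-- Here the arc wraps around. By minimality of `j` the entries in between have values above `v k`
-- and at most `u k`: reaching `u j` above `u k` gives a Bruhat edge, reaching it at or below `v k`
-- a quantum edge.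
... | j , (k<j , inj₂ (y<x , x<uj⊎uj≤y)) , min = finish x<uj⊎uj≤y
  where
  low : ∀ p → toℕ k < toℕ p → toℕ p < toℕ j → toℕ (v k) < toℕ (u p)
  low p k<p p<j = ≰⇒> λ up≤y → min p p<j (k<p , inj₂ (y<x , inj₂ up≤y))
  high : ∀ p → toℕ k < toℕ p → toℕ p < toℕ j → toℕ (u p) ≤ toℕ (u k)
  high p k<p p<j = ≮⇒≥ λ x<up → min p p<j (k<p , inj₂ (y<x , inj₁ x<up))
  bounds : ∀ p → toℕ k ≤ toℕ p → toℕ p < toℕ j → toℕ (v k) < toℕ (u p) × toℕ (u p) ≤ toℕ (u k)
  bounds p k≤p p<j with m≤n⇒m<n∨m≡n k≤p
  ... | inj₂ e rewrite toℕ-injective e = y<x , ≤-refl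
  ... | inj₁ k<p = low p k<p p<j , high p k<p p<j
  above-x : ∀ {b} → toℕ (u k) < b → ∀ p → toℕ k ≤ toℕ p → toℕ p < toℕ j → Avoids b (toℕ (v k)) (toℕ (u p))
  above-x x<b p k≤p p<j with bounds p k≤p p<j
  ... | y<up , up≤x = inj₂ (y<up , ≤-<-trans up≤x x<b)
  finish : toℕ (u k) < toℕ (u j) ⊎ toℕ (u j) ≤ toℕ (v k) → Progress u v
  finish (inj₁ x<uj) = progress-up u-perm k<j agree avoid x<uj
    λ p k<p p<j x<up _ → contradiction (high p k<p p<j) (<⇒≱ x<up)
    where
    avoid : ∀ b → Arc (toℕ (u k)) (toℕ (u j)) b → ∀ p → toℕ k ≤ toℕ p → toℕ p < toℕ j → Avoids b (toℕ (v k)) (toℕ (u p))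
    avoid b (inj₁ (x<b , _)) = above-x x<b
    avoid b (inj₂ (uj<x , _)) = contradiction uj<x (<⇒≯ x<uj)
  finish (inj₂ uj≤y) = progress-down u-perm k<j agree avoid (≤-<-trans uj≤y y<x)
    λ p k<p p<j → ≤-<-trans uj≤y (low p k<p p<j) ,
      ≤∧≢⇒< (high p k<p p<j) (perm-≢ u-perm (toℕ-<⇒≢ k<p ∘ sym))
    where
    avoid : ∀ b → Arc (toℕ (u k)) (toℕ (u j)) b → ∀ p → toℕ k ≤ toℕ p → toℕ p < toℕ j → Avoids b (toℕ (v k)) (toℕ (u p))
    avoid b (inj₁ (x<b , _)) = above-x x<b
    avoid b (inj₂ (_ , inj₁ x<b)) = above-x x<b
    avoid b (inj₂ (_ , inj₂ b≤uj)) p k≤p p<j = inj₁ (≤-trans b≤uj uj≤y , inj₂ (proj₁ (bounds p k≤p p<j)))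

-- Each step raises `inv u - 2 * totalD u v`, which stays below `N`; hence `N + 2 * totalD u v` is
-- enough fuel from any start.
short-path : ∀ {n} {u v : Fun n} → IsPerm u → IsPerm v →
  Σ ℕ λ d → QPath u v d × d + (inv u + 2 * K n) ≤ inv v + 2 * totalD u v
short-path {n} {u} {v} u-perm v-perm = go (N + 2 * totalD u v) u-perm (m≤n+m _ (inv u))
  where
  N : ℕ
  N = suc (n * (n * 1))
  go : ∀ fuel {u} → IsPerm u → N + 2 * totalD u v ≤ inv u + fuel →
    Σ ℕ λ d → QPath u v d × d + (inv u + 2 * K n) ≤ inv v + 2 * totalD u v
  go zero {u} u-perm h = contradiction (≤-trans (m≤m+n N _) h) (<⇒≱ (s≤s (≤-trans (≤-reflexive (+-identityʳ (inv u))) (inv≤n*n u))))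
  go (suc fuel) {u} u-perm h with all? (λ p → u p ≟ᶠ v p)
  ... | yes u≗v = 0 , here u≗v , +-mono-≤ (≤-reflexive (inv-cong u≗v)) (*-monoʳ-≤ 2 (sum-mono _ _ λ m →
        ≤-trans (≤-reflexive (trans (sym (below+above (s≤s⁻¹ (toℕ<n m)) v 0)) (sym (excess-cong (toℕ m) u≗v (λ _ → refl) 0))))
          (excess≤D (toℕ m) u v 0)))
  ... | no u≇v with least (λ p → ¬? (u p ≟ᶠ v p)) (¬∀⟶∃¬ n _ (λ p → u p ≟ᶠ v p) u≇v)
  ...   | k , uk≢vk , min with progress u-perm k (λ p p<k → decidable-stable (u p ≟ᶠ v p) (min p p<k)) v-perm uk≢vk
  ...     | z , e , step with go fuel (edge-perm u-perm e) (linear (+-mono-≤ h step) (lemma N (inv u) (inv z) (totalD u v) (totalD z v) fuel))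
    where
    lemma : ∀ N u z U Z f → N + 2 * Z + (u + suc f + (z + 2 * U)) ≡ z + f + (N + 2 * U + (1 + u + 2 * Z))
    lemma = solve-∀
  ...       | d , π , short = suc d , there e π , linear (+-mono-≤ short step) (lemma d (inv u) (inv z) (inv v) (totalD u v) (totalD z v) (K n))
    where
    lemma : ∀ d u z v U Z k → suc d + (u + 2 * k) + (v + 2 * Z + (z + 2 * U)) ≡ v + 2 * U + (d + (z + 2 * k) + (1 + u + 2 * Z))
    lemma = solve-∀

-- The distance formula and tilted intervals

distance : ∀ {n} {x y : Fun n} {d} → IsPerm x → IsPerm y → QDist x y d → d + (inv x + 2 * K n) ≡ inv y + 2 * totalD x y
distance {n} {x} {y} {d} x-perm y-perm (π , minimal) with short-path x-perm y-perm
... | e , ρ , short with d ≤? e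
...   | yes d≤e = ≤-antisym (≤-trans (+-monoˡ-≤ (inv x + 2 * K n) d≤e) short) (path-bound x-perm π)
...   | no d≰e = contradiction ρ (minimal e (≰⇒> d≰e))

shortest : ∀ {n} {x y : Fun n} {d} → IsPerm x → QPath x y d → d + (inv x + 2 * K n) ≤ inv y + 2 * totalD x y → QDist x y d
shortest x-perm π short = π , λ k k<d ρ →
  <⇒≱ k<d (+-cancelʳ-≤ _ _ _ (≤-trans short (path-bound x-perm ρ)))

-- Equivalent to u[m] ≤_r v[m].
Peak : ∀ {n} → ℕ → Fun n → Fun n → Fin n → Set
Peak m u v r = D m u v ≤ excess m u v (toℕ r)

module _ {n} {u v w : Fun n} (u-perm : IsPerm u) (v-perm : IsPerm v) (w-perm : IsPerm w) where

  -- Summing the three instances of the distance formula; the triangle inequality is then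
  -- an equality for every prefix length separately.
  tilted-D : InTilted u v w → ∀ {m} → m ≤ n → D m u w + D m w v ≤ D m u v + m
  tilted-D (d₁ , d₂ , d , dist₁ , dist₂ , dist , refl) {m} m≤n =
    subst (λ m → D m u w + D m w v ≤ D m u v + m) (toℕ-fromℕ< (s≤s m≤n))
      (≤-reflexive (sym (sum-≤-≡ {suc n} _ _ (λ m → D-triangle (s≤s⁻¹ (toℕ<n m)) u w v) total (fromℕ< (s≤s m≤n)))))
    where
    total : sum {suc n} (λ m → D (toℕ m) u w + D (toℕ m) w v) ≤ sum {suc n} (λ m → D (toℕ m) u v + toℕ m)
    total = ≤-trans (≤-reflexive (sum-+ _ _)) (≤-trans
      (halve-≤ (linear (+-mono-≤ (+-mono-≤
        (≤-reflexive (sym (distance u-perm w-perm dist₁)))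
        (≤-reflexive (sym (distance w-perm v-perm dist₂))))
        (≤-trans (≤-reflexive (distance u-perm v-perm dist)) (n≤1+n _)))
        (lemma d₁ d₂ (inv u) (inv v) (inv w) (K n) (totalD u w) (totalD w v) (totalD u v))))
      (≤-reflexive (sym (sum-+ _ _))))
      where
      lemma : ∀ a b u v w k X Y Z →
        2 * (X + Y) + (a + (u + 2 * k) + (b + (w + 2 * k)) + suc (v + 2 * Z)) ≡
        1 + 2 * (Z + k) + (w + 2 * X + (v + 2 * Y) + (a + b + (u + 2 * k)))
      lemma = solve-∀

  -- At a peak of the whole the two excesses add up to the two maxima, and neither exceeds its own
  -- maximum.
  tilted-peak : InTilted u v w → ∀ {m r} → m ≤ n → Peak m u v r → Peak m u w r × Peak m w v r
  tilted-peak w∈ {m} {r} m≤n peak =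
    linear (+-mono-≤ sums (excess≤D m w v b)) (lemma (D m u w) (excess m u w b) (D m w v) (excess m w v b)) ,
    linear (+-mono-≤ sums (excess≤D m u w b)) (lemma' (D m u w) (excess m u w b) (D m w v) (excess m w v b))
    where
    b : ℕ
    b = toℕ r
    sums : D m u w + D m w v ≤ excess m u w b + excess m w v b
    sums = ≤-trans (tilted-D w∈ m≤n) (≤-trans (+-monoˡ-≤ m peak) (≤-reflexive (sym (excess-chain m≤n u w v b))))
    lemma : ∀ A a B b → A + (a + b + B) ≡ a + (A + B + b)
    lemma = solve-∀
    lemma' : ∀ A a B b → B + (a + b + A) ≡ b + (A + B + a)
    lemma' = solve-∀

  -- The lower bound for one piece and the triangle inequality leave the other piece no more than
  -- its formula allows.
  split-geodesic : ∀ {d₁ d₂ d} → QDist u v d → QPath u w d₁ → QPath w v d₂ → d₁ + d₂ ≡ d → InTilted u v w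
  split-geodesic {d₁} {d₂} dist π ρ refl = d₁ , d₂ , d₁ + d₂ ,
    shortest u-perm π (linear
      (+-mono-≤ (+-mono-≤ (≤-reflexive (distance u-perm v-perm dist)) (path-bound w-perm ρ)) (*-monoʳ-≤ 2 (totalD-triangle u w v)))
      (lemma d₁ d₂ (inv u) (inv v) (inv w) (K n) (totalD u w) (totalD w v) (totalD u v))) ,
    shortest w-perm ρ (linear
      (+-mono-≤ (+-mono-≤ (≤-reflexive (distance u-perm v-perm dist)) (path-bound u-perm π)) (*-monoʳ-≤ 2 (totalD-triangle u w v)))
      (lemma' d₁ d₂ (inv u) (inv v) (inv w) (K n) (totalD u w) (totalD w v) (totalD u v))) ,
    dist , refl
    where
    lemma : ∀ a b u v w k X Y Z →
      a + (u + 2 * k) + (v + 2 * Z + (b + (w + 2 * k)) + 2 * (X + Y)) ≡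
      w + 2 * X + (a + b + (u + 2 * k) + (v + 2 * Y) + 2 * (Z + k))
    lemma = solve-∀
    lemma' : ∀ a b u v w k X Y Z →
      b + (w + 2 * k) + (v + 2 * Z + (a + (u + 2 * k)) + 2 * (X + Y)) ≡
      v + 2 * Y + (a + b + (u + 2 * k) + (w + 2 * X) + 2 * (Z + k))
    lemma' = solve-∀

  -- A cut where both maxima are attained turns the triangle inequality for `m` into an equality;
  -- summed over `m`, the distances add up.
  tilted-intro : (∀ {m} → m ≤ n → Σ (Fin n) λ r → Peak m u w r × Peak m w v r) → InTilted u v w
  tilted-intro peaks with short-path u-perm w-perm | short-path w-perm v-perm | short-path u-perm v-perm
  ... | d₁ , π , short₁ | d₂ , ρ , short₂ | d , σ , short = d₁ , d₂ , d ,
    shortest u-perm π short₁ , shortest w-perm ρ short₂ , dist ,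
    ≤-antisym
      (linear (+-mono-≤ (+-mono-≤ (+-mono-≤ short₁ short₂) (path-bound u-perm σ)) (*-monoʳ-≤ 2 total))
        (lemma d₁ d₂ d (inv u) (inv v) (inv w) (K n) (totalD u w) (totalD w v) (totalD u v)))
      (linear (+-mono-≤ (+-mono-≤ (+-mono-≤ short (path-bound u-perm π)) (path-bound w-perm ρ)) (*-monoʳ-≤ 2 (totalD-triangle u w v)))
        (lemma' d₁ d₂ d (inv u) (inv v) (inv w) (K n) (totalD u w) (totalD w v) (totalD u v)))
    where
    dist : QDist u v d
    dist = shortest u-perm σ short
    total : totalD u w + totalD w v ≤ totalD u v + K n
    total = ≤-trans (≤-reflexive (sym (sum-+ _ _))) (≤-trans (sum-mono _ _ pointwise) (≤-reflexive (sum-+ _ _)))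
      where
      pointwise : ∀ (m : Fin (suc n)) → D (toℕ m) u w + D (toℕ m) w v ≤ D (toℕ m) u v + toℕ m
      pointwise m with peaks (s≤s⁻¹ (toℕ<n m))
      ... | r , peak₁ , peak₂ = ≤-trans (+-mono-≤ peak₁ peak₂)
        (≤-trans (≤-reflexive (excess-chain (s≤s⁻¹ (toℕ<n m)) u w v (toℕ r))) (+-monoˡ-≤ (toℕ m) (excess≤D (toℕ m) u v (toℕ r))))
    lemma : ∀ a b d u v w k X Y Z →
      a + b + (w + 2 * X + (v + 2 * Y) + (d + (u + 2 * k)) + 2 * (Z + k)) ≡
      d + (a + (u + 2 * k) + (b + (w + 2 * k)) + (v + 2 * Z) + 2 * (X + Y))
    lemma = solve-∀
    lemma' : ∀ a b d u v w k X Y Z →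
      d + (v + 2 * Z + (a + (u + 2 * k)) + (b + (w + 2 * k)) + 2 * (X + Y)) ≡
      a + b + (d + (u + 2 * k) + (w + 2 * X) + (v + 2 * Y) + 2 * (Z + k))
    lemma' = solve-∀

-- The cyclic orders

-- The cyclic comparison of `x` and `b` differs from the linear one exactly when `r` separates them;
-- the indicators of lying below `r` correct for this.
key-identity : ∀ {n} (r x b : Fin n) → ⟦ key r x < key r b ⟧ + ⟦ toℕ x < toℕ r ⟧ ≡ ⟦ toℕ x < toℕ b ⟧ + ⟦ toℕ b < toℕ r ⟧
key-identity {n} r x b with toℕ r ≤ᵇ toℕ x | ≤ᵇ-reflects-≤ (toℕ r) (toℕ x) | toℕ r ≤ᵇ toℕ b | ≤ᵇ-reflects-≤ (toℕ r) (toℕ b)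
... | true | ofʸ r≤x | true | ofʸ r≤b = cong₂ _+_
  (⟦<⟧-cong (λ l → ≰⇒> λ b≤x → <⇒≱ l (∸-monoˡ-≤ (toℕ r) b≤x)) (λ l → ∸-monoˡ-< l r≤x))
  (trans (⟦<⟧-no r≤x) (sym (⟦<⟧-no r≤b)))
... | true | ofʸ r≤x | false | ofⁿ r≰b = trans
  (cong₂ _+_ (⟦<⟧-yes (∸-monoˡ-< (<-≤-trans (toℕ<n x) (m≤n+m n (toℕ b))) r≤x)) (⟦<⟧-no r≤x))
  (sym (cong₂ _+_ (⟦<⟧-no {toℕ x} {toℕ b} (≤-trans (<⇒≤ (≰⇒> r≰b)) r≤x)) (⟦<⟧-yes (≰⇒> r≰b))))
... | false | ofⁿ r≰x | true | ofʸ r≤b = trans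
  (cong₂ _+_ (⟦<⟧-no {toℕ x + n ∸ toℕ r} {toℕ b ∸ toℕ r} (∸-monoˡ-≤ (toℕ r) (≤-trans (<⇒≤ (toℕ<n b)) (m≤n+m n (toℕ x))))) (⟦<⟧-yes (≰⇒> r≰x)))
  (sym (cong₂ _+_ (⟦<⟧-yes (<-≤-trans (≰⇒> r≰x) r≤b)) (⟦<⟧-no r≤b)))
... | false | ofⁿ r≰x | false | ofⁿ r≰b = cong₂ _+_
  (⟦<⟧-cong
    (λ l → ≰⇒> λ b≤x → <⇒≱ l (∸-monoˡ-≤ (toℕ r) (+-monoˡ-≤ n b≤x)))
    (λ l → ∸-monoˡ-< (+-monoˡ-< n l) (≤-trans (<⇒≤ (toℕ<n r)) (m≤n+m n (toℕ x)))))
  (trans (⟦<⟧-yes (≰⇒> r≰x)) (sym (⟦<⟧-yes (≰⇒> r≰b))))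

inCyc-key : ∀ {n} (r b x : Fin n) → (if inCyc r b x then 1 else 0) ≡ ⟦ key r x < key r b ⟧
inCyc-key r b x = +-cancelʳ-≡ ⟦ toℕ x < toℕ r ⟧ _ _ (trans identity (sym (key-identity r x b)))
  where
  identity : (if inCyc r b x then 1 else 0) + ⟦ toℕ x < toℕ r ⟧ ≡ ⟦ toℕ x < toℕ b ⟧ + ⟦ toℕ b < toℕ r ⟧
  identity with toℕ r ≤ᵇ toℕ b | ≤ᵇ-reflects-≤ (toℕ r) (toℕ b) | toℕ r ≤ᵇ toℕ x | ≤ᵇ-reflects-≤ (toℕ r) (toℕ x)
              | toℕ x <ᵇ toℕ b | <ᵇ-reflects-< (toℕ x) (toℕ b)
  ... | true | ofʸ r≤b | true | ofʸ r≤x | true | ofʸ x<b rewrite ⟦<⟧-no r≤x | ⟦<⟧-yes x<b | ⟦<⟧-no r≤b = refl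
  ... | true | ofʸ r≤b | true | ofʸ r≤x | false | ofⁿ x≮b rewrite ⟦<⟧-no r≤x | ⟦<⟧-no (≮⇒≥ x≮b) | ⟦<⟧-no r≤b = refl
  ... | true | ofʸ r≤b | false | ofⁿ r≰x | _ | _ rewrite ⟦<⟧-yes (≰⇒> r≰x) | ⟦<⟧-yes (<-≤-trans (≰⇒> r≰x) r≤b) | ⟦<⟧-no r≤b = refl
  ... | false | ofⁿ r≰b | true | ofʸ r≤x | _ | _
    rewrite ⟦<⟧-no r≤x | ⟦<⟧-no {toℕ x} {toℕ b} (≤-trans (<⇒≤ (≰⇒> r≰b)) r≤x) | ⟦<⟧-yes (≰⇒> r≰b) = refl
  ... | false | ofⁿ r≰b | false | ofⁿ r≰x | true | ofʸ x<b rewrite ⟦<⟧-yes (≰⇒> r≰x) | ⟦<⟧-yes x<b | ⟦<⟧-yes (≰⇒> r≰b) = refl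
  ... | false | ofⁿ r≰b | false | ofⁿ r≰x | false | ofⁿ x≮b rewrite ⟦<⟧-yes (≰⇒> r≰x) | ⟦<⟧-no (≮⇒≥ x≮b) | ⟦<⟧-yes (≰⇒> r≰b) = refl

-- For distinct values with equal keys, `key-identity` in both orders would add up to `1 + S ≡ S`.
key-injective : ∀ {n} (r : Fin n) {x y : Fin n} → key r x ≡ key r y → x ≡ y
key-injective r {x} {y} e with toℕ x ≟ toℕ y
... | yes x≡y = toℕ-injective x≡y
... | no x≢y = contradiction (≤-reflexive absurd) 1+n≰n
  where
  half : ∀ {x y : Fin _} → key r x ≡ key r y → ⟦ toℕ x < toℕ r ⟧ ≡ ⟦ toℕ x < toℕ y ⟧ + ⟦ toℕ y < toℕ r ⟧
  half {x} {y} e = trans (cong (_+ ⟦ toℕ x < toℕ r ⟧) (sym (⟦<⟧-no {key r x} {key r y} (≤-reflexive (sym e))))) (key-identity r x y)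
  lemma : ∀ a b c d → (a + b) + (c + d) ≡ (a + d) + (b + c)
  lemma = solve-∀
  absurd : 1 + (⟦ toℕ x < toℕ r ⟧ + ⟦ toℕ y < toℕ r ⟧) ≡ ⟦ toℕ x < toℕ r ⟧ + ⟦ toℕ y < toℕ r ⟧
  absurd = trans (cong (_+ (⟦ toℕ x < toℕ r ⟧ + ⟦ toℕ y < toℕ r ⟧)) (sym (⟦<⟧-total (toℕ x) (toℕ y) x≢y)))
    (trans (lemma ⟦ toℕ x < toℕ y ⟧ ⟦ toℕ y < toℕ x ⟧ ⟦ toℕ x < toℕ r ⟧ ⟦ toℕ y < toℕ r ⟧)
      (sym (cong₂ _+_ (half e) (half (sym e)))))

-- The tilted order in terms of peaks

count : ∀ {n} → Fin n → ℕ → Fun n → Fin n → ℕ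
count r m w b = prefixSum m (λ p → ⟦ key r (w p) < key r b ⟧)

count-identity : ∀ {n} (r : Fin n) m (w : Fun n) b →
  count r m w b + below m w (toℕ r) ≡ below m w (toℕ b) + prefixSum {n} m (λ _ → ⟦ toℕ b < toℕ r ⟧)
count-identity r m w b = trans (sym (prefixSum-+ m _ _))
  (trans (prefixSum-cong m λ p → key-identity r (w p) b) (prefixSum-+ m _ _))

-- In other words, `e_m(b) - e_m(r)` is the count for `v` minus the count for `u`. So `r` is a
-- maximiser exactly when `u` has at least as many entries as `v` below every threshold of `<_r`.
excess-count : ∀ {n m} → m ≤ n → (r : Fin n) (u v : Fun n) (b : Fin n) →
  excess m u v (toℕ b) + count r m u b ≡ excess m u v (toℕ r) + count r m v b
excess-count {n} {m} m≤n r u v b = +-cancelʳ-≡ (below m u (toℕ r)) _ _ (begin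
  below m v (toℕ b) + above m u (toℕ b) + count r m u b + below m u (toℕ r)
    ≡⟨ lemma₁ (below m v (toℕ b)) (above m u (toℕ b)) (count r m u b) (below m u (toℕ r)) ⟩
  below m v (toℕ b) + (above m u (toℕ b) + (count r m u b + below m u (toℕ r)))
    ≡⟨ cong (λ x → below m v (toℕ b) + (above m u (toℕ b) + x)) (count-identity r m u b) ⟩
  below m v (toℕ b) + (above m u (toℕ b) + (below m u (toℕ b) + T))
    ≡⟨ lemma₂ (below m v (toℕ b)) (above m u (toℕ b)) (below m u (toℕ b)) T ⟩
  (below m v (toℕ b) + T) + (below m u (toℕ b) + above m u (toℕ b))
    ≡⟨ cong₂ _+_ (sym (count-identity r m v b)) (trans (below+above m≤n u (toℕ b)) (sym (below+above m≤n u (toℕ r)))) ⟩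
  (count r m v b + below m v (toℕ r)) + (below m u (toℕ r) + above m u (toℕ r))
    ≡⟨ lemma₃ (count r m v b) (below m v (toℕ r)) (below m u (toℕ r)) (above m u (toℕ r)) ⟩
  below m v (toℕ r) + above m u (toℕ r) + count r m v b + below m u (toℕ r) ∎)
  where
  open ≡-Reasoning
  T : ℕ
  T = prefixSum {n} m (λ _ → ⟦ toℕ b < toℕ r ⟧)
  lemma₁ : ∀ a b c d → a + b + c + d ≡ a + (b + (c + d))
  lemma₁ = solve-∀
  lemma₂ : ∀ a b c d → a + (b + (c + d)) ≡ (a + d) + (c + b)
  lemma₂ = solve-∀
  lemma₃ : ∀ a b c d → (a + b) + (c + d) ≡ b + d + a + c
  lemma₃ = solve-∀

-- The counting form of `u[m] ≤_r v[m]`, wrapped in a record so that `r`, `m`, `u` and `v` can be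
-- recovered by unification.
record Dominates {n : ℕ} (r : Fin n) (m : ℕ) (u v : Fun n) : Set where
  constructor dominating
  field count-≤ : ∀ b → count r m v b ≤ count r m u b

open Dominates

peak⇒dominates : ∀ {n m} → m ≤ n → {r : Fin n} {u v : Fun n} → Peak m u v r → Dominates r m u v
peak⇒dominates {n} {m} m≤n {r} {u} {v} peak = dominating λ b → linear
  (+-mono-≤ (≤-reflexive (sym (excess-count m≤n r u v b))) (≤-trans (excess≤D m u v (toℕ b)) peak))
  (lemma (count r m u b) (count r m v b) (excess m u v (toℕ b)) (excess m u v (toℕ r)))
  where
  lemma : ∀ u v b r → v + (b + u + r) ≡ u + (r + v + b)
  lemma = solve-∀

dominates⇒peak : ∀ {n m} → m ≤ n → {r : Fin n} {u v : Fun n} → Dominates r m u v → Peak m u v r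
dominates⇒peak {suc n} {m} m≤n {r} {u} {v} dom = D-least m u v bound
  where
  bound-Fin : ∀ b → excess m u v (toℕ b) ≤ excess m u v (toℕ r)
  bound-Fin b = +-cancelʳ-≤ (count r m u b) _ _
    (≤-trans (≤-reflexive (excess-count m≤n r u v b)) (+-monoʳ-≤ (excess m u v (toℕ r)) (count-≤ dom b)))
  bound : ∀ b → excess m u v b ≤ excess m u v (toℕ r)
  bound b with b <? suc n
  ... | yes b<n = subst (λ x → excess m u v x ≤ excess m u v (toℕ r)) (toℕ-fromℕ< b<n) (bound-Fin (fromℕ< b<n))
  ... | no b≮n = ≤-trans (≤-reflexive (excess-beyond m u v (≮⇒≥ b≮n))) (bound-Fin zero)

-- Entrywise comparison of sorted lists by counting.

countBelow : ℕ → List ℕ → ℕ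
countBelow t xs = listSum (map (λ x → ⟦ x < t ⟧) xs)

countBelow-sort : ∀ t xs → countBelow t (sort xs) ≡ countBelow t xs
countBelow-sort t xs = sum-↭ (map⁺ _ (InsertionSort.sort-↭ xs))

pointwise⇒countBelow : ∀ {xs ys} → Pointwise _≤_ xs ys → ∀ t → countBelow t ys ≤ countBelow t xs
pointwise⇒countBelow [] t = z≤n
pointwise⇒countBelow {x ∷ _} {y ∷ _} (x≤y ∷ h) t =
  +-mono-≤ (⟦<⟧-mono {y} {t} (≤-<-trans x≤y)) (pointwise⇒countBelow h t)

countBelow-sorted : ∀ {t x xs} → t ≤ x → Sorted (x ∷ xs) → countBelow t (x ∷ xs) ≡ 0
countBelow-sorted t≤x [-] = cong (_+ 0) (⟦<⟧-no t≤x)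
countBelow-sorted t≤x (x≤y ∷ ys↗) = cong₂ _+_ (⟦<⟧-no t≤x) (countBelow-sorted (≤-trans t≤x x≤y) ys↗)

countBelow⇒pointwise : ∀ {xs ys} → Sorted xs → Sorted ys → length xs ≡ length ys →
  (∀ t → countBelow t ys ≤ countBelow t xs) → Pointwise _≤_ xs ys
countBelow⇒pointwise {[]} {[]} _ _ _ _ = []
countBelow⇒pointwise {x ∷ xs} {y ∷ ys} xs↗ ys↗ len h =
  x≤y ∷ countBelow⇒pointwise (sorted-tail xs↗) (sorted-tail ys↗) (suc-injective len) tails
  where
  x≤y : x ≤ y
  -- At the threshold `suc y` the second list counts its head, whereas with `y < x` the first would
  -- count nothing.
  x≤y = ≮⇒≥ λ y<x → contradiction
    (≤-trans (≤-trans (≤-reflexive (sym (⟦<⟧-yes (n<1+n y)))) (m≤m+n _ (countBelow (suc y) ys)))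
      (≤-trans (h (suc y)) (≤-reflexive (countBelow-sorted y<x xs↗)))) (λ ())
  tails : ∀ t → countBelow t ys ≤ countBelow t xs
  tails t with cmp y t
  ... | geq t≤y e _ = ≤-trans (m≤n+m _ ⟦ y < t ⟧) (≤-trans (≤-reflexive (countBelow-sorted t≤y ys↗)) z≤n)
  ... | less y<t e _ = +-cancelˡ-≤ 1 _ _ (subst₂ (λ a b → a + countBelow t ys ≤ b + countBelow t xs) e (⟦<⟧-yes (≤-<-trans x≤y y<t)) (h t))

listSum-take : ∀ {n} {A : Set} (h : A → ℕ) (e : Fin n → A) k → listSum (map h (take k (tabulate e))) ≡ prefixSum k (h ∘ e)
listSum-take h e zero = sym (prefixSum-zero (h ∘ e))
listSum-take {zero} h e (suc k) = sym (sum-empty _)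
listSum-take {suc n} h e (suc k) = trans (cong (h (e zero) +_) (listSum-take h (e ∘ suc) k)) (sym (prefixSum-head k (h ∘ e)))

listSum-prefix : ∀ {n} (h : Fin n → ℕ) (w : Fun n) k → listSum (map h (prefix w k)) ≡ prefixSum k (h ∘ w)
listSum-prefix h w k = trans (cong listSum (sym (map-∘ (take k (allFin _))))) (listSum-take (h ∘ w) (λ p → p) k)

key<n : ∀ {n} (r x : Fin n) → key r x < n
key<n {suc n} r x with toℕ r ≤ᵇ toℕ x | ≤ᵇ-reflects-≤ (toℕ r) (toℕ x)
... | true | _ = ≤-<-trans (m∸n≤m (toℕ x) (toℕ r)) (toℕ<n x)
... | false | ofⁿ r≰x = m<n+o⇒m∸n<o (toℕ x + suc n) (toℕ r) (+-monoˡ-< (suc n) (≰⇒> r≰x))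

-- `Dominates` tests only thresholds of the form `key r b`; this makes every `t < n` available.
key-surjective : ∀ {n} (r : Fin n) {t} → t < n → ∃ λ b → key r b ≡ t
key-surjective r t<n with perm-surjective {w = λ x → fromℕ< (key<n r x)} injective (fromℕ< t<n)
  where
  injective : IsPerm (λ x → fromℕ< (key<n r x))
  injective x y e = key-injective r (trans (sym (toℕ-fromℕ< (key<n r x))) (trans (cong toℕ e) (toℕ-fromℕ< (key<n r y))))
... | b , e = b , trans (sym (toℕ-fromℕ< (key<n r b))) (trans (cong toℕ e) (toℕ-fromℕ< t<n))

countBelow-prefix : ∀ {n} (r : Fin n) (w : Fun n) k t →
  countBelow t (sort (map (key r) (prefix w k))) ≡ prefixSum k (λ p → ⟦ key r (w p) < t ⟧)
countBelow-prefix r w k t = trans (countBelow-sort t (map (key r) (prefix w k)))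
  (trans (cong listSum (sym (map-∘ {g = λ x → ⟦ x < t ⟧} {f = key r} (prefix w k)))) (listSum-prefix (λ x → ⟦ key r x < t ⟧) w k))

gale⇒dominates : ∀ {n} {r : Fin n} {u v : Fun n} k → GaleLe r (prefix u k) (prefix v k) → Dominates r k u v
gale⇒dominates {r = r} {u} {v} k gale = dominating λ b →
  subst₂ _≤_ (countBelow-prefix r v k (key r b)) (countBelow-prefix r u k (key r b)) (pointwise⇒countBelow gale (key r b))

dominates⇒gale : ∀ {n} {r : Fin n} {u v : Fun n} k → Dominates r k u v → GaleLe r (prefix u k) (prefix v k)
dominates⇒gale {n} {r} {u} {v} k dom = countBelow⇒pointwise (InsertionSort.sort-↗ (map (key r) (prefix u k))) (InsertionSort.sort-↗ (map (key r) (prefix v k)))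
  (trans (size u) (sym (size v)))
  λ t → subst₂ _≤_ (sym (countBelow-prefix r v k t)) (sym (countBelow-prefix r u k t)) (bound t)
  where
  size : ∀ w → length (sort (map (key r) (prefix w k))) ≡ length (take k (allFin n))
  size w = trans (↭-length (InsertionSort.sort-↭ (map (key r) (prefix w k)))) (trans (length-map (key r) (prefix w k)) (length-map w (take k (allFin n))))
  bound : ∀ t → prefixSum k (λ p → ⟦ key r (v p) < t ⟧) ≤ prefixSum k (λ p → ⟦ key r (u p) < t ⟧)
  bound t with t <? n
  ... | no t≮n = ≤-reflexive (prefixSum-cong k λ p →
          trans (⟦<⟧-yes (<-≤-trans (key<n r (v p)) (≮⇒≥ t≮n))) (sym (⟦<⟧-yes (<-≤-trans (key<n r (u p)) (≮⇒≥ t≮n)))))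
  ... | yes t<n with key-surjective r t<n
  ...   | b , refl = count-≤ dom b

countCyc-count : ∀ {n} (r b : Fin n) (w : Fun n) k → countCyc r b (prefix w k) ≡ count r k w b
countCyc-count r b w k = trans (listSum-prefix (λ x → if inCyc r b x then 1 else 0) w k)
  (prefixSum-cong k λ p → inCyc-key r b (w p))

peak-empty : ∀ {n} {u v : Fun n} r → Peak 0 u v r
peak-empty {u = u} {v} r = D-least 0 u v λ b →
  ≤-trans (≤-reflexive (trans (excess-term 0 u v b) (prefixSum-zero _))) z≤n

-- For consecutive `p` and `q`, the cyclic interval from `a p` to `a q` is an initial segment of the
-- order starting at `a p`. Equal counts on it therefore say that `a q` has the same excess as the
-- peak `a p` at the length they share.
leA⇒peaks : ∀ {n} (a : Fin n → Fin n) {u v : Fun n} → LeA a u v →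
  ∀ p → Peak (toℕ p) u v (a p) × Peak (suc (toℕ p)) u v (a p)
leA⇒peaks {n} a {u} {v} (gale , cyc) p = before p , here-peak p
  where
  here-peak : ∀ p → Peak (suc (toℕ p)) u v (a p)
  here-peak p = dominates⇒peak (toℕ<n p) {r = a p} (gale⇒dominates {r = a p} (suc (toℕ p)) (gale p))
  before : ∀ p → Peak (toℕ p) u v (a p)
  before zero = peak-empty (a zero)
  before q@(suc p) = subst (λ m → Peak (suc m) u v (a q)) (toℕ-inject₁ p)
    (≤-trans (here-peak p') (≤-reflexive (sym same)))
    where
    p' : Fin _
    p' = inject₁ p
    counts : count (a p') (suc (toℕ p')) u (a q) ≡ count (a p') (suc (toℕ p')) v (a q)
    counts = trans (sym (countCyc-count (a p') (a q) u _))
      (trans (cyc p' q (cong suc (sym (toℕ-inject₁ p)))) (countCyc-count (a p') (a q) v _))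
    same : excess (suc (toℕ p')) u v (toℕ (a q)) ≡ excess (suc (toℕ p')) u v (toℕ (a p'))
    same = +-cancelʳ-≡ (count (a p') (suc (toℕ p')) u (a q)) _ _
      (trans (excess-count (toℕ<n p') (a p') u v (a q)) (cong (excess (suc (toℕ p')) u v (toℕ (a p')) +_) (sym counts)))

peaks⇒leA : ∀ {n} {a : Fin n → Fin n} {u v : Fun n} →
  (∀ p → Peak (toℕ p) u v (a p) × Peak (suc (toℕ p)) u v (a p)) → LeA a u v
peaks⇒leA {n} {a} {u} {v} peaks =
  (λ p → dominates⇒gale {r = a p} (suc (toℕ p)) (peak⇒dominates (toℕ<n p) (proj₂ (peaks p)))) , cyc
  where
  cyc : ∀ p q → toℕ q ≡ suc (toℕ p) →
    countCyc (a p) (a q) (prefix u (suc (toℕ p))) ≡ countCyc (a p) (a q) (prefix v (suc (toℕ p)))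
  cyc p q q≡ = trans (countCyc-count (a p) (a q) u _) (trans counts (sym (countCyc-count (a p) (a q) v _)))
    where
    m : ℕ
    m = suc (toℕ p)
    same : excess m u v (toℕ (a q)) ≡ excess m u v (toℕ (a p))
    same = ≤-antisym (≤-trans (excess≤D m u v _) (proj₂ (peaks p)))
      (≤-trans (excess≤D m u v _) (subst (λ m → Peak m u v (a q)) q≡ (proj₁ (peaks q))))
    counts : count (a p) m u (a q) ≡ count (a p) m v (a q)
    counts = +-cancelˡ-≡ (excess m u v (toℕ (a p))) _ _
      (trans (cong (_+ count (a p) m u (a q)) (sym same)) (excess-count (toℕ<n p) (a p) u v (a q)))

-- The two indicators are monotone in opposite directions: for `u < v` they are never both 1, and
-- for `v ≤ u` never both 0.
term-range : ∀ u v → ∃ λ c → ∀ b → c ≤ term u v b × term u v b ≤ suc c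
term-range u v with u <? v
... | yes u<v = 0 , λ b → z≤n , ≤-trans
  (+-monoˡ-≤ ⟦ b < suc u ⟧ (⟦<⟧-mono {v} {b} (<-trans u<v))) (≤-reflexive (⟦<⟧-complement u b))
... | no u≮v = 1 , λ b → ≤-trans (≤-reflexive (sym (⟦<⟧-complement u b)))
    (+-monoˡ-≤ ⟦ b < suc u ⟧ (⟦<⟧-mono {u} {b} (≤-<-trans (≮⇒≥ u≮v)))) ,
  +-mono-≤ (⟦<⟧≤1 v b) (⟦<⟧≤1 b (suc u))

excess-suc : ∀ {n} (k : Fin n) (u v : Fun n) b →
  excess (suc (toℕ k)) u v b ≡ excess (toℕ k) u v b + term (toℕ (u k)) (toℕ (v k)) b
excess-suc k u v b = trans (excess-term (suc (toℕ k)) u v b)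
  (trans (prefixSum-suc k _) (cong (_+ term (toℕ (u k)) (toℕ (v k)) b) (sym (excess-term (toℕ k) u v b))))

-- The excess functions of consecutive prefixes differ by a function with values in {c, c + 1},
-- so if some maximiser of the second does not maximise the first, every maximiser of the first works.
common-peak : ∀ {n} (u v : Fun n) k → ∃ λ r → Peak (toℕ k) u v r × Peak (suc (toℕ k)) u v r
common-peak u v k with D-attained k (suc (toℕ k)) u v | D-attained k (toℕ k) u v | term-range (toℕ (u k)) (toℕ (v k))
... | r , eᵣ | s , eₛ | c , range with D (toℕ k) u v ≤? excess (toℕ k) u v (toℕ r)
...   | yes peak = r , peak , ≤-reflexive (sym eᵣ)
...   | no ¬peak = s , ≤-reflexive (sym eₛ) , (begin
  D (suc (toℕ k)) u v ≡⟨ sym eᵣ ⟩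
  excess (suc (toℕ k)) u v (toℕ r) ≡⟨ excess-suc k u v (toℕ r) ⟩
  excess (toℕ k) u v (toℕ r) + t (toℕ r) ≤⟨ +-monoʳ-≤ (excess (toℕ k) u v (toℕ r)) (proj₂ (range (toℕ r))) ⟩
  excess (toℕ k) u v (toℕ r) + suc c ≡⟨ +-suc (excess (toℕ k) u v (toℕ r)) c ⟩
  suc (excess (toℕ k) u v (toℕ r)) + c ≤⟨ +-mono-≤ (≤-trans (≰⇒> ¬peak) (≤-reflexive (sym eₛ))) (proj₁ (range (toℕ s))) ⟩
  excess (toℕ k) u v (toℕ s) + t (toℕ s) ≡⟨ sym (excess-suc k u v (toℕ s)) ⟩
  excess (suc (toℕ k)) u v (toℕ s) ∎)
  where
  open ≤-Reasoning
  t : ℕ → ℕ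
  t = term (toℕ (u k)) (toℕ (v k))

-- Exchanging adjacent positions

module _ {n} {i i' : Fin n} (i'≡ : toℕ i' ≡ suc (toℕ i)) where

  private
    s : Fin n → Fin n
    s = swapF i i'

    i<i' : toℕ i < toℕ i'
    i<i' = ≤-reflexive (sym i'≡)

  prefixSum-swap-same : ∀ {m} → ¬ (m ≡ suc (toℕ i)) → (h : Fin n → ℕ) → prefixSum m (h ∘ s) ≡ prefixSum m h
  prefixSum-swap-same {m} m≢ h = trans (sym (+-identityʳ _)) (trans
    (subst (λ ω → prefixSum m (h ∘ s) + ω * h i ≡ prefixSum m h + ω * h i') empty (prefixSum-swap m i<i' h)) (+-identityʳ _))
    where
    empty : window (toℕ i) (toℕ i') m ≡ 0
    empty with cmp (toℕ i) m
    ... | geq _ e _ = cong (_* ⟦ m < suc (toℕ i') ⟧) e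
    ... | less i<m e _ = cong₂ _*_ e
            (⟦<⟧-no {m} {suc (toℕ i')} (subst (λ x → suc x ≤ m) (sym i'≡) (≤∧≢⇒< i<m (m≢ ∘ sym))))

  prefixSum-swap-middle : ∀ (h : Fin n → ℕ) → prefixSum (suc (toℕ i)) (h ∘ s) ≡ prefixSum (toℕ i) h + h i'
  prefixSum-swap-middle h = trans (prefixSum-suc i (h ∘ s))
    (cong₂ _+_ (prefixSum-swap-same (<⇒≢ (n<1+n (toℕ i))) h) (cong h (swapF-left i i')))

  count-same : ∀ {m} → ¬ (m ≡ suc (toℕ i)) → ∀ r (w : Fun n) b → count r m (w ∘ s) b ≡ count r m w b
  count-same m≢ r w b = prefixSum-swap-same m≢ (λ p → ⟦ key r (w p) < key r b ⟧)

  count-swap : ∀ r (w : Fun n) b → count r (suc (toℕ i)) (w ∘ s) b ≡ count r (toℕ i) w b + ⟦ key r (w i') < key r b ⟧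
  count-swap r w b = prefixSum-swap-middle (λ p → ⟦ key r (w p) < key r b ⟧)

  count-middle : ∀ r (w : Fun n) b → count r (suc (toℕ i)) w b ≡ count r (toℕ i) w b + ⟦ key r (w i) < key r b ⟧
  count-middle r w b = prefixSum-suc i _

  count-next : ∀ r (w : Fun n) b → count r (suc (toℕ i')) w b ≡
    count r (toℕ i) w b + ⟦ key r (w i) < key r b ⟧ + ⟦ key r (w i') < key r b ⟧
  count-next r w b = trans (prefixSum-suc i' _) (cong (_+ ⟦ key r (w i') < key r b ⟧)
    (trans (cong (λ m → count r m w b) i'≡) (count-middle r w b)))

  ascent⇒dominates : ∀ {r} {w : Fun n} → w i <[ r ] w i' → Dominates r (suc (toℕ i)) w (w ∘ s)
  ascent⇒dominates {r} {w} asc = dominating λ b → subst₂ _≤_ (sym (count-swap r w b)) (sym (count-middle r w b))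
    (+-monoʳ-≤ (count r (toℕ i) w b) (⟦<⟧-mono {key r (w i')} {key r b} (<-trans asc)))

  descent⇒dominates : ∀ {r} {w : Fun n} → w i' <[ r ] w i → Dominates r (suc (toℕ i)) (w ∘ s) w
  descent⇒dominates {r} {w} des = dominating λ b → subst₂ _≤_ (sym (count-middle r w b)) (sym (count-swap r w b))
    (+-monoʳ-≤ (count r (toℕ i) w b) (⟦<⟧-mono {key r (w i)} {key r b} (<-trans des)))

  key-≢ : ∀ r {w : Fun n} → IsPerm w → ¬ (key r (w i) ≡ key r (w i'))
  key-≢ r w-perm e = toℕ-<⇒≢ i<i' (w-perm i i' (key-injective r e))

  -- Tested at `b = w i`: if `w i'` came first, the exchanged prefix would have one entry more below
  -- `b` than the original one.
  dominates⇒ascent : ∀ {r} {w : Fun n} → IsPerm w → Dominates r (suc (toℕ i)) w (w ∘ s) → w i <[ r ] w i'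
  dominates⇒ascent {r} {w} w-perm dom with cmp (key r (w i')) (key r (w i))
  ... | geq i≤i' _ _ = ≤∧≢⇒< i≤i' (key-≢ r w-perm)
  ... | less _ e _ = contradiction (+-cancelˡ-≤ (count r (toℕ i) w (w i)) 1 0
    (subst₂ (λ x y → count r (toℕ i) w (w i) + x ≤ count r (toℕ i) w (w i) + y) e (⟦<⟧-no {key r (w i)} ≤-refl)
      (subst₂ _≤_ (count-swap r w (w i)) (count-middle r w (w i)) (count-≤ dom (w i))))) (λ ())

  dominates⇒descent : ∀ {r} {w : Fun n} → IsPerm w → Dominates r (suc (toℕ i)) (w ∘ s) w → w i' <[ r ] w i
  dominates⇒descent {r} {w} w-perm dom with cmp (key r (w i)) (key r (w i'))
  ... | geq i'≤i _ _ = ≤∧≢⇒< i'≤i (key-≢ r w-perm ∘ sym)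
  ... | less _ e _ = contradiction (+-cancelˡ-≤ (count r (toℕ i) w (w i')) 1 0
    (subst₂ (λ x y → count r (toℕ i) w (w i') + x ≤ count r (toℕ i) w (w i') + y) e (⟦<⟧-no {key r (w i')} ≤-refl)
      (subst₂ _≤_ (count-middle r w (w i')) (count-swap r w (w i')) (count-≤ dom (w i'))))) (λ ())

  -- The lifting property: average the inequalities for the prefixes of lengths i - 1 and i + 1.
  lift-left : ∀ {r} {u v : Fun n} → Dominates r (toℕ i) u v → Dominates r (suc (toℕ i')) u v →
    v i' <[ r ] v i → Dominates r (suc (toℕ i)) (u ∘ s) v
  lift-left {r} {u} {v} before after des = dominating λ b → subst₂ _≤_ (sym (count-middle r v b)) (sym (count-swap r u b))
    (halve-≤ (linear
      (+-mono-≤ (+-mono-≤ (count-≤ before b) (subst₂ _≤_ (count-next r v b) (count-next r u b) (count-≤ after b)))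
        (+-mono-≤ (+-mono-≤ (⟦<⟧-mono {key r (v i)} {key r b} (<-trans des)) (⟦<⟧≤1 (key r (u i)) (key r b))) (z≤n {⟦ key r (u i') < key r b ⟧})))
      (lemma (count r (toℕ i) v b) (count r (toℕ i) u b) ⟦ key r (v i) < key r b ⟧ ⟦ key r (v i') < key r b ⟧
        ⟦ key r (u i) < key r b ⟧ ⟦ key r (u i') < key r b ⟧)))
    where
    lemma : ∀ a c x x' y y' → 2 * (a + x) + (c + (c + y + y') + (x' + 1 + y')) ≡
      1 + 2 * (c + y') + (a + (a + x + x') + (x + y + 0))
    lemma = solve-∀

  -- The ascent of `u` gives `y' ≤ y` for its two indicators. Replacing the indicator `x'` of `v i'`
  -- by 1 costs the unit that `halve-≤` removes.
  lift-right : ∀ {r} {u v : Fun n} → Dominates r (toℕ i) u v → Dominates r (suc (toℕ i')) u v →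
    u i <[ r ] u i' → Dominates r (suc (toℕ i)) u (v ∘ s)
  lift-right {r} {u} {v} before after asc = dominating λ b → subst₂ _≤_ (sym (count-swap r v b)) (sym (count-middle r u b))
    (halve-≤ (linear
      (+-mono-≤ (+-mono-≤ (count-≤ before b) (subst₂ _≤_ (count-next r v b) (count-next r u b) (count-≤ after b)))
        (+-mono-≤ (+-mono-≤ (⟦<⟧-mono {key r (u i')} {key r b} (<-trans asc)) (⟦<⟧≤1 (key r (v i')) (key r b))) (z≤n {⟦ key r (v i) < key r b ⟧})))
      (lemma (count r (toℕ i) v b) (count r (toℕ i) u b) ⟦ key r (v i) < key r b ⟧ ⟦ key r (v i') < key r b ⟧
        ⟦ key r (u i) < key r b ⟧ ⟦ key r (u i') < key r b ⟧)))
    where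
    lemma : ∀ a c x x' y y' → 2 * (a + x') + (c + (c + y + y') + (y + 1 + x)) ≡
      1 + 2 * (c + y) + (a + (a + x + x') + (y' + x' + 0))
    lemma = solve-∀

-- Membership in tilted intervals through domination.

Dominates-trans : ∀ {n} {r : Fin n} {m u w v} → Dominates r m u w → Dominates r m w v → Dominates r m u v
Dominates-trans d e = dominating λ b → ≤-trans (count-≤ e b) (count-≤ d b)

Dominates-refl : ∀ {n} {r : Fin n} {m} {u : Fun n} → Dominates r m u u
Dominates-refl = dominating λ b → ≤-refl

-- Every peak is quantified over, which makes membership strong to use, while `dominates⇒inTilted`
-- asks for a single cut per length to establish it.
Tilted : ∀ {n} → Fun n → Fun n → Fun n → Set
Tilted {n} u v w = ∀ {m r} → m ≤ n → Peak m u v r → Dominates r m u w × Dominates r m w v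

module _ {n} {u v w : Fun n} (u-perm : IsPerm u) (v-perm : IsPerm v) (w-perm : IsPerm w) where

  inTilted⇒tilted : InTilted u v w → Tilted u v w
  inTilted⇒tilted w∈ m≤n peak with tilted-peak u-perm v-perm w-perm w∈ m≤n peak
  ... | peak₁ , peak₂ = peak⇒dominates m≤n peak₁ , peak⇒dominates m≤n peak₂

  dominates⇒inTilted : Fin n → (∀ m → m ≤ n → Σ (Fin n) λ r → Dominates r m u w × Dominates r m w v) → InTilted u v w
  dominates⇒inTilted p dom = tilted-intro u-perm v-perm w-perm λ {m} m≤n → let r , d₁ , d₂ = dom m m≤n in
    r , dominates⇒peak m≤n d₁ , dominates⇒peak m≤n d₂

tilted⇒inTilted : ∀ {n} {u v w : Fun n} → IsPerm u → IsPerm v → IsPerm w → Fin n → Tilted u v w → InTilted u v w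
tilted⇒inTilted {u = u} {v} u-perm v-perm w-perm p tilted = dominates⇒inTilted u-perm v-perm w-perm p λ m m≤n →
  let r , e = D-attained p m u v in r , tilted m≤n (≤-reflexive (sym e))

Tilted-left : ∀ {n} {u v : Fun n} → Tilted u v u
Tilted-left m≤n peak = Dominates-refl , peak⇒dominates m≤n peak

Tilted-right : ∀ {n} {u v : Fun n} → Tilted u v v
Tilted-right m≤n peak = peak⇒dominates m≤n peak , Dominates-refl

Tilted-cong : ∀ {n} {u v w z : Fun n} → w ≗ z → Tilted u v w → Tilted u v z
Tilted-cong {u = u} {v} {w} {z} w≗z tilted {m} {r} m≤n peak with tilted m≤n peak
... | d₁ , d₂ = dominating (λ b → subst (_≤ count r m u b) (same b) (count-≤ d₁ b)) ,
                  dominating (λ b → subst (count r m v b ≤_) (same b) (count-≤ d₂ b))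
  where
  same : ∀ b → count r m w b ≡ count r m z b
  same b = prefixSum-cong m λ p → cong (λ x → ⟦ key r x < key r b ⟧) (w≗z p)

-- Only the prefix of length `suc (toℕ i)` has a different entry set after the exchange, so one cut
-- at that length is all that has to be supplied.
swap-tilted : ∀ {n} {u v w : Fun n} {i i' r : Fin n} → toℕ i' ≡ suc (toℕ i) →
  IsPerm u → IsPerm v → IsPerm w → Tilted u v w →
  Dominates r (suc (toℕ i)) u (w ∘ swapF i i') → Dominates r (suc (toℕ i)) (w ∘ swapF i i') v →
  InTilted u v (w ∘ swapF i i')
swap-tilted {n} {u} {v} {w} {i} {i'} {r} i'≡ u-perm v-perm w-perm tilted d₁ d₂ =
  dominates⇒inTilted u-perm v-perm (swapF-perm i i' w-perm) i dom
  where
  dom : ∀ m → m ≤ n → Σ (Fin n) λ r → Dominates r m u (w ∘ swapF i i') × Dominates r m (w ∘ swapF i i') v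
  dom m m≤n with m ≟ suc (toℕ i)
  ... | yes refl = r , d₁ , d₂
  ... | no m≢ with D-attained i m u v
  ...   | r' , e with tilted m≤n (≤-reflexive (sym e))
  ...     | e₁ , e₂ = r' ,
    dominating (λ b → ≤-trans (≤-reflexive (count-same i'≡ m≢ r' w b)) (count-≤ e₁ b)) ,
    dominating (λ b → ≤-trans (count-≤ e₂ b) (≤-reflexive (sym (count-same i'≡ m≢ r' w b))))

Triple : ∀ {n} → Fun n → Fun n → Fin n → Fin n → Fin n → Set
Triple u v i i' r = Peak (toℕ i) u v r × Peak (suc (toℕ i)) u v r × Peak (suc (toℕ i')) u v r

leA⇒triple : ∀ {n} (a : Fin n → Fin n) {u v : Fun n} {i i'} → LeA a u v → a i ≡ a i' → Triple u v i i' (a i)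
leA⇒triple a {u} {v} {i} {i'} le e = proj₁ (leA⇒peaks a le i) , proj₂ (leA⇒peaks a le i) ,
  subst (Peak (suc (toℕ i')) u v) (sym e) (proj₂ (leA⇒peaks a le i'))

-- In terms of peaks the conditions at different positions are independent: `r` is used at `i` and
-- `i'`, and `common-peak` fills the rest.
triple⇒leA : ∀ {n} {u v : Fun n} {i i' r : Fin n} → toℕ i' ≡ suc (toℕ i) → Triple u v i i' r → Σ (Fin _ → Fin _) λ a → LeA a u v × a i ≡ a i'
triple⇒leA {n} {u} {v} {i} {i'} {r} i'≡ (peak₀ , peak₁ , peak₂) = a , peaks⇒leA peaks , a-const
  where
  a : Fin n → Fin n
  a p with p ≟ᶠ i | p ≟ᶠ i'
  ... | yes _ | _ = r
  ... | no _ | yes _ = r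
  ... | no _ | no _ = proj₁ (common-peak u v p)
  peaks : ∀ p → Peak (toℕ p) u v (a p) × Peak (suc (toℕ p)) u v (a p)
  peaks p with p ≟ᶠ i | p ≟ᶠ i'
  ... | yes refl | _ = peak₀ , peak₁
  ... | no _ | yes refl = subst (λ m → Peak m u v r) (sym i'≡) peak₁ , peak₂
  ... | no _ | no _ = proj₂ (common-peak u v p)
  a-const : a i ≡ a i'
  a-const with i ≟ᶠ i | i ≟ᶠ i' | i' ≟ᶠ i | i' ≟ᶠ i'
  ... | no i≢i | _ | _ | _ = contradiction refl i≢i
  ... | yes _ | _ | yes _ | _ = refl
  ... | yes _ | _ | no _ | yes _ = refl
  ... | yes _ | _ | no _ | no i'≢i' = contradiction refl i'≢i'

module _ {n} {u v : Fun n} (u-perm : IsPerm u) (v-perm : IsPerm v) {i i' : Fin n} (i'≡ : toℕ i' ≡ suc (toℕ i)) where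

  -- If `w` ascends at `i`, then `w s_i` lies above `w`, hence above `u`, and lifting with the
  -- descent of `v` keeps it below `v`. If `w` descends, the roles of `u` and `v` are exchanged.
  triple-tilted : ∀ {r} → Triple u v i i' r → u i <[ r ] u i' → v i' <[ r ] v i →
    ∀ {w} → IsPerm w → Tilted u v w → InTilted u v (w ∘ swapF i i')
  triple-tilted {r} (peak₀ , peak₁ , peak₂) asc des {w} w-perm tilted with cmp (key r (w i)) (key r (w i'))
  ... | less asc-w _ _ = swap-tilted {r = r} i'≡ u-perm v-perm w-perm tilted
    (Dominates-trans {w = w} (proj₁ (tilted (toℕ<n i) peak₁)) (ascent⇒dominates i'≡ asc-w))
    (lift-left i'≡ (proj₂ (tilted (<⇒≤ (toℕ<n i)) peak₀)) (proj₂ (tilted (toℕ<n i') peak₂)) des)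
  ... | geq i'≤i _ _ = swap-tilted {r = r} i'≡ u-perm v-perm w-perm tilted
    (lift-right i'≡ (proj₁ (tilted (<⇒≤ (toℕ<n i)) peak₀)) (proj₁ (tilted (toℕ<n i') peak₂)) asc)
    (Dominates-trans {w = w} (descent⇒dominates i'≡ (≤∧≢⇒< i'≤i (key-≢ i'≡ r w-perm ∘ sym))) (proj₂ (tilted (toℕ<n i) peak₁)))

  ascent-at-peak : ∀ {r} → Peak (suc (toℕ i)) u v r → InTilted u v (u ∘ swapF i i') → u i <[ r ] u i'
  ascent-at-peak peak us∈ = dominates⇒ascent i'≡ u-perm
    (proj₁ (inTilted⇒tilted u-perm v-perm (swapF-perm i i' u-perm) us∈ (toℕ<n i) peak))

  descent-at-peak : ∀ {r} → Peak (suc (toℕ i)) u v r → InTilted u v (v ∘ swapF i i') → v i' <[ r ] v i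
  descent-at-peak peak vs∈ = dominates⇒descent i'≡ v-perm
    (proj₂ (inTilted⇒tilted u-perm v-perm (swapF-perm i i' v-perm) vs∈ (toℕ<n i) peak))

-- Separating pairs of cuts

data Side (r s x : ℕ) : Set where
  same  : ⟦ x < r ⟧ ≡ ⟦ x < s ⟧ → ⟦ r < suc x ⟧ ≡ ⟦ s < suc x ⟧ → Side r s x
  split : ⟦ x < r ⟧ ≡ 0 → ⟦ x < s ⟧ ≡ 1 → ⟦ r < suc x ⟧ ≡ 1 → ⟦ s < suc x ⟧ ≡ 0 → Side r s x

side : ∀ {r s} → r < s → ∀ x → Side r s x
side {r} {s} r<s x with cmp x r | cmp x s
... | less _ e f | less _ e' f' = same (trans e (sym e')) (trans f (sym f'))
... | geq _ e f | geq _ e' f' = same (trans e (sym e')) (trans f (sym f'))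
... | geq _ e f | less _ e' f' = split e e' f f'
... | less x<r _ _ | geq s≤x _ _ = contradiction (<-trans x<r r<s) (≤⇒≯ s≤x)

-- For `r < s` this means that `x` lies outside the interval from `r` (inclusive) to `s`
-- (exclusive).
Together : ℕ → ℕ → ℕ → Set
Together r s x = ⟦ x < r ⟧ ≡ ⟦ x < s ⟧

-- From cut `r` to cut `s` the term gains one if `v` lies in between and loses one if `u` does; a
-- strict gain leaves one possibility.
term-increases : ∀ {r s} → r < s → ∀ u v → term u v r < term u v s → Together r s u × ¬ Together r s v
term-increases {r} {s} r<s u v l with side r<s u | side r<s v
... | same e f | same e' f' = contradiction (cong₂ _+_ e' f) (<⇒≢ l)
... | same e f | split e' f' _ _ = e , λ t → contradiction (trans (sym e') (trans t f')) λ ()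
... | split e f e' f' | _ rewrite e' | f' = contradiction (≤-trans l (+-monoˡ-≤ 0 (⟦<⟧≤1 v s))) (≤⇒≯ (m≤n+m 1 ⟦ v < r ⟧))

term-decreases : ∀ {r s} → r < s → ∀ u v → term u v s < term u v r → ¬ Together r s u × Together r s v
term-decreases {r} {s} r<s u v l with side r<s u | side r<s v
... | same e f | same e' f' = contradiction (sym (cong₂ _+_ e' f)) (<⇒≢ l)
... | split e f _ _ | same e' f' = (λ t → contradiction (trans (sym e) (trans t f)) λ ()) , e'
... | _ | split e f e' f' rewrite e | f = contradiction (≤-trans l (⟦<⟧≤1 r (suc u))) (≤⇒≯ (m≤m+n 1 _))

-- A transposition that moves both `i` and `i'` exchanges them with each other.
swapF-cases : ∀ {n} (p q : Fin n) {i i' : Fin n} → i ≢ i' →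
  swapF p q i ≡ i ⊎ swapF p q i' ≡ i' ⊎ swapF p q i ≡ i'
swapF-cases p q {i} {i'} i≢i' with i ≟ᶠ p | i ≟ᶠ q | i' ≟ᶠ p | i' ≟ᶠ q
... | no _ | no _ | _ | _ = inj₁ refl
... | yes i≡p | _ | yes i'≡p | _ = contradiction (trans i≡p (sym i'≡p)) i≢i'
... | yes _ | _ | no _ | yes i'≡q = inj₂ (inj₂ (sym i'≡q))
... | yes _ | _ | no _ | no _ = inj₂ (inj₁ refl)
... | no _ | yes _ | yes i'≡p | _ = inj₂ (inj₂ (sym i'≡p))
... | no _ | yes i≡q | no _ | yes i'≡q = contradiction (trans i≡q (sym i'≡q)) i≢i'
... | no _ | yes _ | no _ | no _ = inj₂ (inj₁ refl)

path-perm : ∀ {n} {x y : Fun n} {d} → IsPerm x → QPath x y d → IsPerm y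
path-perm x-perm (here x≗y) = perm-cong (sym ∘ x≗y) x-perm
path-perm x-perm (there e π) = path-perm (edge-perm x-perm e) π

-- After one exchange the pair at `i` and `i'` still shows one of its previous entries. A
-- one-coloured pair therefore cannot change colour in one step, and a path that ends with the other
-- colour at `i` passes through a two-coloured pair.
crossing : ∀ {n} (χ : Fin n → Bool) {i i' : Fin n} → i ≢ i' → {x y : Fun n} {d : ℕ} → QPath x y d →
  χ (x i) ≡ χ (x i') → ¬ (χ (x i) ≡ χ (y i)) →
  Σ (Fun n) λ w → Σ ℕ λ d₁ → Σ ℕ λ d₂ → QPath x w d₁ × QPath w y d₂ × d₁ + d₂ ≡ d × ¬ (χ (w i) ≡ χ (w i'))
crossing χ {i} i≢i' (here x≗y) _ x≢y = contradiction (cong χ (x≗y i)) x≢y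
crossing χ {i} {i'} i≢i' {x} (there {z = z} {d = d} e@(p , q , _ , z≗ , _) π) x≡ x≢y with χ (z i) ≟ᵇ χ (z i')
... | no z≢ = z , 1 , d , there e (here (λ _ → refl)) , π , refl , z≢
... | yes z≡ with crossing χ i≢i' π z≡ (λ z≡y → x≢y (trans (sym same-colour) z≡y))
  where
  same-colour : χ (z i) ≡ χ (x i)
  same-colour with swapF-cases p q i≢i'
  ... | inj₁ fix = cong χ (trans (z≗ i) (cong x fix))
  ... | inj₂ (inj₁ fix) = trans z≡ (trans (cong χ (trans (z≗ i') (cong x fix))) (sym x≡))
  ... | inj₂ (inj₂ moved) = trans (cong χ (trans (z≗ i) (cong x moved))) (sym x≡)
...   | w , d₁ , d₂ , π₁ , π₂ , eq , w≢ = w , suc d₁ , d₂ , there e π₁ , π₂ , cong suc eq , w≢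

excess-swap : ∀ {n} {i i' : Fin n} → toℕ i' ≡ suc (toℕ i) → (u w : Fun n) (b : ℕ) →
  excess (suc (toℕ i)) u (w ∘ swapF i i') b + ⟦ toℕ (w i) < b ⟧ ≡ excess (suc (toℕ i)) u w b + ⟦ toℕ (w i') < b ⟧
excess-swap {i = i} {i'} i'≡ u w b = trans
  (cong (λ x → x + above (suc (toℕ i)) u b + ⟦ toℕ (w i) < b ⟧) (prefixSum-swap-middle i'≡ (λ p → ⟦ toℕ (w p) < b ⟧)))
  (trans (lemma (below (toℕ i) w b) ⟦ toℕ (w i') < b ⟧ (above (suc (toℕ i)) u b) ⟦ toℕ (w i) < b ⟧)
    (cong (λ x → x + above (suc (toℕ i)) u b + ⟦ toℕ (w i') < b ⟧) (sym (prefixSum-suc i (λ p → ⟦ toℕ (w p) < b ⟧)))))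
  where
  lemma : ∀ a x' c x → a + x' + c + x ≡ a + x + c + x'
  lemma = solve-∀

module _ {n} {u v : Fun n} (u-perm : IsPerm u) (v-perm : IsPerm v) {i i' : Fin n} (i'≡ : toℕ i' ≡ suc (toℕ i))
  (invariant : ∀ w → IsPerm w → InTilted u v w → InTilted u v (w ∘ swapF i i')) where

  private
    k : ℕ
    k = suc (toℕ i)

    -- The colour tells on which of the two arcs between the cuts `r` and `s` a value lies.
    -- Comparing indicators makes it independent of the order of `r` and `s`.
    χ : Fin n → Fin n → Fin n → Bool
    χ r s x = does (⟦ toℕ x < toℕ r ⟧ ≟ ⟦ toℕ x < toℕ s ⟧)

    χ-true : ∀ r s x → Together (toℕ r) (toℕ s) (toℕ x) → χ r s x ≡ true
    χ-true r s x = dec-true (⟦ toℕ x < toℕ r ⟧ ≟ ⟦ toℕ x < toℕ s ⟧)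

    χ-false : ∀ r s x → ¬ Together (toℕ r) (toℕ s) (toℕ x) → χ r s x ≡ false
    χ-false r s x = dec-false (⟦ toℕ x < toℕ r ⟧ ≟ ⟦ toℕ x < toℕ s ⟧)

    constant-at-peaks : ∀ {r s w} → IsPerm w → InTilted u v w → Peak k u v r → Peak k u v s →
      excess k u w (toℕ r) ≡ excess k u w (toℕ s)
    constant-at-peaks w-perm w∈ peakᵣ peakₛ = ≤-antisym
      (≤-trans (excess≤D k u _ _) (proj₁ (tilted-peak u-perm v-perm w-perm w∈ (toℕ<n i) peakₛ)))
      (≤-trans (excess≤D k u _ _) (proj₁ (tilted-peak u-perm v-perm w-perm w∈ (toℕ<n i) peakᵣ)))

  -- Both w and w s_i lie in [u,v], so their excess functions agree at r and s; they differ by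
  -- [w_{i+1} < b] - [w_i < b], which must therefore take the same value at r and s.
  same-side : ∀ {r s w} → IsPerm w → InTilted u v w → Peak k u v r → Peak k u v s → χ r s (w i) ≡ χ r s (w i')
  same-side {r} {s} {w} w-perm w∈ peakᵣ peakₛ = compare
    where
    X : Fun n → Fin n → ℕ
    X z b = excess k u z (toℕ b)
    at : ∀ p b → ℕ
    at p b = ⟦ toℕ (w p) < toℕ b ⟧
    balance : at i r + at i' s ≡ at i s + at i' r
    balance = +-cancelˡ-≡ (X (w ∘ swapF i i') r + X w s) _ _ (begin
      X (w ∘ swapF i i') r + X w s + (at i r + at i' s)
        ≡⟨ lemma (X (w ∘ swapF i i') r) (X w s) (at i r) (at i' s) ⟩
      (X (w ∘ swapF i i') r + at i r) + (X w s + at i' s)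
        ≡⟨ cong₂ _+_ (excess-swap i'≡ u w (toℕ r)) (sym (excess-swap i'≡ u w (toℕ s))) ⟩
      (X w r + at i' r) + (X (w ∘ swapF i i') s + at i s)
        ≡⟨ cong₂ (λ x y → (x + at i' r) + (y + at i s)) (constant-at-peaks w-perm w∈ peakᵣ peakₛ)
             (sym (constant-at-peaks (swapF-perm i i' w-perm) (invariant w w-perm w∈) peakᵣ peakₛ)) ⟩
      (X w s + at i' r) + (X (w ∘ swapF i i') r + at i s)
        ≡⟨ lemma' (X w s) (at i' r) (X (w ∘ swapF i i') r) (at i s) ⟩
      X (w ∘ swapF i i') r + X w s + (at i s + at i' r) ∎)
      where
      open ≡-Reasoning
      lemma : ∀ a b c d → a + b + (c + d) ≡ (a + c) + (b + d)
      lemma = solve-∀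
      lemma' : ∀ b d a c → (b + d) + (a + c) ≡ a + b + (c + d)
      lemma' = solve-∀
    compare : χ r s (w i) ≡ χ r s (w i')
    compare with at i r ≟ at i s | at i' r ≟ at i' s
    ... | yes e | yes e' = trans (χ-true r s (w i) e) (sym (χ-true r s (w i') e'))
    ... | no e | no e' = trans (χ-false r s (w i) e) (sym (χ-false r s (w i') e'))
    ... | yes e | no e' = contradiction (sym (+-cancelˡ-≡ (at i s) _ _ (subst (λ x → x + at i' s ≡ at i s + at i' r) e balance))) e'
    ... | no e | yes e' = contradiction (+-cancelʳ-≡ (at i' s) _ _ (subst (λ x → at i r + at i' s ≡ at i s + x) e' balance)) e

  no-separation : ∀ {r s} → Peak k u v r → Peak k u v s →
    χ r s (u i) ≡ χ r s (u i') → ¬ (χ r s (u i) ≡ χ r s (v i)) → ⊥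
  no-separation {r} {s} peakᵣ peakₛ u≡ u≢v with short-path u-perm v-perm
  ... | d , π , short with crossing (χ r s) (toℕ-<⇒≢ (≤-reflexive (sym i'≡))) π u≡ u≢v
  ...   | w , d₁ , d₂ , π₁ , π₂ , eq , w≢ = w≢ (same-side {r} {s} (path-perm u-perm π₁)
    (split-geodesic u-perm v-perm (path-perm u-perm π₁) (shortest u-perm π short) π₁ π₂ eq) peakᵣ peakₛ)

  -- `r` is a peak at lengths `i` and `i + 1`, `s` at `i + 1` and `i + 2`, with `i` counted from 0.
  -- If neither serves all three, `s` falls short before their common level and `r` after it, so the
  -- increments at both positions are strictly larger at `s` than at `r`.
  invariant⇒triple : ∃ λ r → Triple u v i i' r
  invariant⇒triple with common-peak u v i | common-peak u v i'
  ... | r , r₀ , r₁ | s , s₁' , s₂ with D (suc (toℕ i')) u v ≤? excess (suc (toℕ i')) u v (toℕ r) | D (toℕ i) u v ≤? excess (toℕ i) u v (toℕ s)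
  ...   | yes r₂ | _ = r , r₀ , r₁ , r₂
  ...   | no _ | yes s₀ = s , s₀ , subst (λ m → Peak m u v s) i'≡ s₁' , s₂
  ...   | no ¬r₂ | no ¬s₀ = ⊥-elim (separated (<-cmp (toℕ r) (toℕ s)))
    where
    s₁ : Peak k u v s
    s₁ = subst (λ m → Peak m u v s) i'≡ s₁'
    t : Fin n → ℕ → ℕ
    t p = term (toℕ (u p)) (toℕ (v p))
    level : excess k u v (toℕ r) ≡ excess k u v (toℕ s)
    level = ≤-antisym (≤-trans (excess≤D k u v _) s₁) (≤-trans (excess≤D k u v _) r₁)
    tᵢ : t i (toℕ r) < t i (toℕ s)
    tᵢ = +-cancelˡ-< (excess (toℕ i) u v (toℕ s)) _ _ (<-≤-trans (+-monoˡ-< (t i (toℕ r)) (≰⇒> λ l → ¬s₀ (≤-trans r₀ l)))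
      (≤-reflexive (trans (sym (excess-suc i u v (toℕ r))) (trans level (excess-suc i u v (toℕ s))))))
    tᵢ' : t i' (toℕ r) < t i' (toℕ s)
    tᵢ' = +-cancelˡ-< (excess k u v (toℕ s)) _ _ (subst₂ _<_ (trans (next r) (cong (_+ t i' (toℕ r)) level)) (next s)
      (≰⇒> λ l → ¬r₂ (≤-trans s₂ l)))
      where
      next : ∀ b → excess (suc (toℕ i')) u v (toℕ b) ≡ excess k u v (toℕ b) + t i' (toℕ b)
      next b = trans (excess-suc i' u v (toℕ b)) (cong (λ m → excess m u v (toℕ b) + t i' (toℕ b)) i'≡)
    separated : Tri (toℕ r < toℕ s) (toℕ r ≡ toℕ s) (toℕ s < toℕ r) → ⊥
    separated (tri≈ _ e _) = <⇒≢ tᵢ (cong (t i) e)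
    separated (tri< r<s _ _) with term-increases r<s (toℕ (u i)) (toℕ (v i)) tᵢ | term-increases r<s (toℕ (u i')) (toℕ (v i')) tᵢ'
    ... | ui , vi | ui' , _ = no-separation {r} {s} r₁ s₁
      (trans (χ-true r s (u i) ui) (sym (χ-true r s (u i') ui')))
      (λ e → contradiction (trans (sym (χ-true r s (u i) ui)) (trans e (χ-false r s (v i) vi))) λ ())
    separated (tri> _ _ s<r) with term-decreases s<r (toℕ (u i)) (toℕ (v i)) tᵢ | term-decreases s<r (toℕ (u i')) (toℕ (v i')) tᵢ'
    ... | ui , vi | ui' , _ = no-separation {r} {s} r₁ s₁
      (trans (χ-false r s (u i) (ui ∘ sym)) (sym (χ-false r s (u i') (ui' ∘ sym))))
      (λ e → contradiction (trans (sym (χ-false r s (u i) (ui ∘ sym))) (trans e (χ-true r s (v i) (sym vi)))) λ ())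

-- As `s_i` is an involution, the equality of sets in (3) amounts to an equivalence between
-- membership of `w` and of `w s_i`.
theorem3p25 : (n : ℕ) (u v : Fin n → Fin n) → IsPerm u → IsPerm v →
    (i i' : Fin n) → toℕ i' ≡ suc (toℕ i) →
    ((Σ (Fin n → Fin n) λ a → LeA a u v × InDes a v i i' × InAsc a u i i')
    ⇔ (Σ (Fin n → Fin n) λ a → LeA a u v × (a i ≡ a i') ×
    InTilted u v (u ∘ swapF i i') × InTilted u v (v ∘ swapF i i')))
    × ((Σ (Fin n → Fin n) λ a → LeA a u v × (a i ≡ a i') ×
    InTilted u v (u ∘ swapF i i') × InTilted u v (v ∘ swapF i i'))
    ⇔ (∀ (w : Fin n → Fin n) → IsPerm w →
    (InTilted u v w ⇔ InTilted u v (w ∘ swapF i i'))))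
theorem3p25 n u v u-perm v-perm i i' i'≡ = mk⇔ 1⇒2 2⇒1 , mk⇔ 2⇒3 3⇒2
  where
  us vs : Fun n
  us = u ∘ swapF i i'
  vs = v ∘ swapF i i'

  1⇒2 : (Σ (Fin n → Fin n) λ a → LeA a u v × InDes a v i i' × InAsc a u i i') →
    Σ (Fin n → Fin n) λ a → LeA a u v × (a i ≡ a i') × InTilted u v us × InTilted u v vs
  1⇒2 (a , le , (a≡ , des) , (_ , asc)) = a , le , a≡ ,
    triple-tilted u-perm v-perm i'≡ (leA⇒triple a le a≡) asc des u-perm Tilted-left ,
    triple-tilted u-perm v-perm i'≡ (leA⇒triple a le a≡) asc des v-perm Tilted-right

  2⇒1 : (Σ (Fin n → Fin n) λ a → LeA a u v × (a i ≡ a i') × InTilted u v us × InTilted u v vs) →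
    Σ (Fin n → Fin n) λ a → LeA a u v × InDes a v i i' × InAsc a u i i'
  2⇒1 (a , le , a≡ , us∈ , vs∈) = a , le ,
    (a≡ , descent-at-peak u-perm v-perm i'≡ (proj₂ (leA⇒peaks a le i)) vs∈) ,
    (a≡ , ascent-at-peak u-perm v-perm i'≡ (proj₂ (leA⇒peaks a le i)) us∈)

  2⇒3 : (Σ (Fin n → Fin n) λ a → LeA a u v × (a i ≡ a i') × InTilted u v us × InTilted u v vs) →
    ∀ w → IsPerm w → InTilted u v w ⇔ InTilted u v (w ∘ swapF i i')
  2⇒3 hyp w w-perm with 2⇒1 hyp
  ... | a , le , (a≡ , des) , (_ , asc) = mk⇔ (closed w-perm)
    -- Closure applied to `w s_i` yields `w s_i s_i`, which agrees with `w` pointwise; membership is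
    -- transported along this through `Tilted`.
    λ ws∈ → tilted⇒inTilted u-perm v-perm w-perm i
      (Tilted-cong (λ p → cong w (swapF-involutive i i' p))
        (inTilted⇒tilted u-perm v-perm (swapF-perm i i' (swapF-perm i i' w-perm)) (closed (swapF-perm i i' w-perm) ws∈)))
    where
    closed : ∀ {z} → IsPerm z → InTilted u v z → InTilted u v (z ∘ swapF i i')
    closed z-perm z∈ = triple-tilted u-perm v-perm i'≡ (leA⇒triple a le a≡) asc des z-perm
      (inTilted⇒tilted u-perm v-perm z-perm z∈)

  3⇒2 : (∀ w → IsPerm w → InTilted u v w ⇔ InTilted u v (w ∘ swapF i i')) →
    Σ (Fin n → Fin n) λ a → LeA a u v × (a i ≡ a i') × InTilted u v us × InTilted u v vs
  3⇒2 invariant with invariant⇒triple u-perm v-perm i'≡ (λ w w-perm → Equivalence.to (invariant w w-perm))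
  ... | r , triple with triple⇒leA i'≡ triple
  ...   | a , le , a≡ = a , le , a≡ ,
    Equivalence.to (invariant u u-perm) (tilted⇒inTilted u-perm v-perm u-perm i Tilted-left) ,
    Equivalence.to (invariant v v-perm) (tilted⇒inTilted u-perm v-perm v-perm i Tilted-right)
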